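{- Let $n\ge 1$ and $u,w\in\mathfrak{W}_n$. If $\mathcal{M}(u)=\mathcal{M}(w)$, then $u\sim_{cid} w$.
   Context: Partitions are Young diagrams in English notation; box $(i,j)$ is in row $i$ from the top, column $j$ from the left. For $\lambda\subseteq\mu$, $\mathrm{Inc}(\mu/\lambda)$ is the set of fillings of $\mu/\lambda$ by positive integers strictly increasing along rows (left to right) and columns (top to bottom). $\sigma_n=(n,n-1,\dots,1)$; $M_n\in\mathrm{Inc}(\sigma_n)$ has entry $i+j-1$ in box $(i,j)$ ($M_0$ empty). An inner corner of $\mu/\lambda$ is a box of $\lambda$ with no box of $\lambda$ immediately right of or below it; an outer corner of $\mu/\lambda$ is a box not in $\mu$ such that the box immediately above it and the box immediately to its left are each either in $\mu$ or outside the positive quadrant. For $T\in\mathrm{Inc}(\mu/\lambda)$ and a set $B$ of inner corners, $\mathrm{jdt}_B(T)$: put a dot in each box of $B$; for $i=1,2,\dots$ up to the largest entry, simultaneously replace each dot having a box containing $i$ immediately below or immediately right of it by $i$, and each such box containing $i$ by a dot; then delete the dots. For $S$ with largest entry $k$ and a set $C$ of outer corners, $\mathrm{rjdt}_C(S)$: put dots in $C$; for $i=k,k-1,\dots,1$, simultaneously replace each dot having a box containing $i$ immediately above or immediately left of it by $i$, and each such box containing $i$ by a dot; then delete the dots. For $T\in\mathrm{Inc}(\lambda)$ with largest entry $k$ and $U\in\mathrm{Inc}(\mu/\lambda)$: with $B_i$ the boxes of $T$ containing $i$, set $U_k=U$, $U_{i-1}=\mathrm{jdt}_{B_i}(U_i)$,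 $\mathrm{jdt}_T(U)=U_0$; with $k'$ the largest entry of $U$ and $C_i$ the boxes of $U$ containing $i$, set $T_1=T$, $T_{i+1}=\mathrm{rjdt}_{C_i}(T_i)$ for $i=1,\dots,k'$, $\mathrm{rjdt}_U(T)=T_{k'+1}$. The K-infusion is $\mathrm{infusion}(T,U)=(\mathrm{jdt}_T(U),\mathrm{rjdt}_U(T))$. $\mathfrak{W}_n$ is the set of words of length $n$ in positive integers; $w\in\mathfrak{W}_n$ is identified with the tableau of shape $\sigma_n/\sigma_{n-1}$ with $w_i$ in box $(n+1-i,i)$. Define $(\mathcal{W}(w),\mathcal{M}(w))=\mathrm{infusion}(M_{n-1},w)$. For a word $x$, $\mathrm{lis}(x)$, $\mathrm{lds}(x)$ are the lengths of a longest strictly increasing, resp. strictly decreasing, subsequence. For $u,w\in\mathfrak{W}_n$, $u\sim_{cid}w$ means that for all $1\le i\le j\le n$, $\mathrm{lis}(u_i\cdots u_j)=\mathrm{lis}(w_i\cdots w_j)$ and $\mathrm{lds}(u_i\cdots u_j)=\mathrm{lds}(w_i\cdots w_j)$. -}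

module Defs where

open import Data.Nat using (ℕ; zero; suc; _+_; _∸_; _⊔_; _<_; _≤_; _≡ᵇ_; _<ᵇ_; _≤ᵇ_)
open import Data.Bool using (Bool; true; false; _∧_; _∨_; if_then_else_)
open import Data.List using (List; []; _∷_; map; foldr; length; take; drop; upTo; concatMap; filter)
open import Data.Vec using (Vec; toList)
open import Data.Product using (_×_; _,_)
open import Relation.Binary.PropositionalEquality using (_≡_)

-- Fillings of (skew) diagrams
--
-- Boxes are (row , column) with rows/columns numbered from 1 (English
-- notation); row 0 / column 0 lie outside the positive quadrant.  A cell
-- is empty, a dot (only used during jeu de taquin), or a positive entry.

data Cell : Set where
  ∅   : Cell
  •   : Cell
  num : ℕ → Cell

Filling : Set
Filling = ℕ → ℕ → Cell

isNum : ℕ → Cell → Bool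
isNum i (num m) = m ≡ᵇ i
isNum i _       = false

isDot : Cell → Bool
isDot • = true
isDot _ = false

above : Filling → ℕ → ℕ → Cell
above F zero    c = ∅
above F (suc r) c = F r c

left : Filling → ℕ → ℕ → Cell
left F r zero    = ∅
left F r (suc c) = F r c

below : Filling → ℕ → ℕ → Cell
below F r c = F (suc r) c

right : Filling → ℕ → ℕ → Cell
right F r c = F r (suc c)

-- largest entry of a filling whose boxes lie in [1..b] × [1..b]
cellVal : Cell → ℕ
cellVal (num m) = m
cellVal _       = 0

maxEntry : ℕ → Filling → ℕ
maxEntry b F = foldr _⊔_ 0 (concatMap (λ r → map (λ c → cellVal (F (suc r) (suc c))) (upTo b)) (upTo b))

overlay : (ℕ → ℕ → Bool) → Filling → Filling
overlay B F r c = if B r c then • else F r c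

deleteDots : Filling → Filling
deleteDots F r c with F r c
... | • = ∅
... | x = x

jdtStep : ℕ → Filling → Filling
jdtStep i F r c with F r c
... | ∅     = ∅
... | •     = if isNum i (below F r c) ∨ isNum i (right F r c) then num i else •
... | num m = if (m ≡ᵇ i) ∧ (isDot (above F r c) ∨ isDot (left F r c)) then • else num m

rjdtStep : ℕ → Filling → Filling
rjdtStep i F r c with F r c
... | ∅     = ∅
... | •     = if isNum i (above F r c) ∨ isNum i (left F r c) then num i else •
... | num m = if (m ≡ᵇ i) ∧ (isDot (below F r c) ∨ isDot (right F r c)) then • else num m

jdtSteps : ℕ → Filling → Filling
jdtSteps zero    F = F
jdtSteps (suc k) F = jdtStep (suc k) (jdtSteps k F)

rjdtSteps : ℕ → Filling → Filling
rjdtSteps zero    F = F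
rjdtSteps (suc k) F = rjdtSteps k (rjdtStep (suc k) F)

-- jdt_B(T) and rjdt_C(S); b bounds the region [1..b]×[1..b] containing all boxes
jdtB : ℕ → (ℕ → ℕ → Bool) → Filling → Filling
jdtB b B T = deleteDots (jdtSteps (maxEntry b T) (overlay B T))

rjdtC : ℕ → (ℕ → ℕ → Bool) → Filling → Filling
rjdtC b C S = deleteDots (rjdtSteps (maxEntry b S) (overlay C S))

boxesWith : Filling → ℕ → ℕ → ℕ → Bool
boxesWith T i r c = isNum i (T r c)

jdtT-go : ℕ → Filling → ℕ → Filling → Filling
jdtT-go b T zero    U = U
jdtT-go b T (suc i) U = jdtT-go b T i (jdtB b (boxesWith T (suc i)) U)

jdtT : ℕ → Filling → Filling → Filling
jdtT b T U = jdtT-go b T (maxEntry b T) U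

rjdtU-go : ℕ → Filling → ℕ → Filling → Filling
rjdtU-go b U zero    T = T
rjdtU-go b U (suc i) T = rjdtC b (boxesWith U (suc i)) (rjdtU-go b U i T)

rjdtU : ℕ → Filling → Filling → Filling
rjdtU b U T = rjdtU-go b U (maxEntry b U) T

infusion : ℕ → Filling → Filling → Filling × Filling
infusion b T U = jdtT b T U , rjdtU b U T

Mstair : ℕ → Filling
Mstair m r c = if (0 <ᵇ r) ∧ (0 <ᵇ c) ∧ (r + c ≤ᵇ suc m) then num (r + c ∸ 1) else ∅

nth : List ℕ → ℕ → ℕ
nth []       _       = 0
nth (x ∷ xs) zero    = x
nth (x ∷ xs) (suc k) = nth xs k

-- word w ∈ 𝔚_n as the tableau of shape σ_n/σ_{n-1}: w_i in box (n+1-i, i)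
wordTableau : (n : ℕ) → Vec ℕ n → Filling
wordTableau n w r c =
  if (0 <ᵇ r) ∧ (0 <ᵇ c) ∧ (r + c ≡ᵇ suc n) then num (nth (toList w) (c ∸ 1)) else ∅

Word : (n : ℕ) → Vec ℕ n → Set
Word n w = ∀ k → k < n → 0 < nth (toList w) k

-- (𝒲(w), ℳ(w)) = infusion(M_{n-1}, w), all boxes inside [1..n]×[1..n]
𝒲 : (n : ℕ) → Vec ℕ n → Filling
𝒲 n w = Data.Product.proj₁ (infusion n (Mstair (n ∸ 1)) (wordTableau n w))

ℳ : (n : ℕ) → Vec ℕ n → Filling
ℳ n w = Data.Product.proj₂ (infusion n (Mstair (n ∸ 1)) (wordTableau n w))

sublists : List ℕ → List (List ℕ)
sublists []       = [] ∷ []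
sublists (x ∷ xs) = let s = sublists xs in Data.List._++_ (map (x ∷_) s) s

strictlyIncr : List ℕ → Bool
strictlyIncr []           = true
strictlyIncr (x ∷ [])     = true
strictlyIncr (x ∷ y ∷ xs) = (x <ᵇ y) ∧ strictlyIncr (y ∷ xs)

strictlyDecr : List ℕ → Bool
strictlyDecr []           = true
strictlyDecr (x ∷ [])     = true
strictlyDecr (x ∷ y ∷ xs) = (y <ᵇ x) ∧ strictlyDecr (y ∷ xs)

lenIf : (List ℕ → Bool) → List ℕ → ℕ
lenIf p s = if p s then length s else 0

lis : List ℕ → ℕ
lis x = foldr _⊔_ 0 (map (lenIf strictlyIncr) (sublists x))

lds : List ℕ → ℕ
lds x = foldr _⊔_ 0 (map (lenIf strictlyDecr) (sublists x))

-- the factor x_i ⋯ x_j (1-indexed)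
factor : List ℕ → ℕ → ℕ → List ℕ
factor x i j = take (suc j ∸ i) (drop (i ∸ 1) x)

_∼cid_ : {n : ℕ} → Vec ℕ n → Vec ℕ n → Set
_∼cid_ {n} u w = ∀ i j → 1 ≤ i → i ≤ j → j ≤ n →
  (lis (factor (toList u) i j) ≡ lis (factor (toList w) i j)) ×
  (lds (factor (toList u) i j) ≡ lds (factor (toList w) i j))

{-# OPTIONS --safe #-}

-- Let ℓ k be the letter in row k + 1, so that w is read from the bottom row to
-- the top row.  The theorem follows from a formula reading lis off ℳ(w):
--
--   lis(w_i ⋯ w_j) = (j - i + 1) - c,
--
-- where c is the least cost of a path through rows 1, …, n + 1 - j of ℳ(w).
-- The path starts in row 1 with the value i; holding value p in row r it either
-- passes to p + 1 in row r, paying 1 if p is an entry of row r, or passes for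
-- free to p + 1 in row r + 1; it ends when p exceeds n.
--
-- The formula is proved for the tableaux obtained after absorbing the letters
-- ≤ v, by induction on v.  The longest chains satisfy an obvious recursion in
-- v, so one has to see how the cost changes when the letters v + 1 are absorbed.
-- A dot in row r changes the number of entries ≥ p there by one, and it climbs
-- from row r + 1 to row r exactly when the two rows are as close as the shape
-- allows, which is also when a path loses nothing by changing rows.
--
-- The whole argument is symmetric under transposition, which exchanges lis
-- with lds of the same factor; so only lds is treated, for letters indexed by
-- rows or by columns.

module Submission where

open import Defs
open import Algebra.Properties.CommutativeSemigroup using (x∙yz≈y∙xz; xy∙z≈xz∙y)
open import Data.Bool using (Bool; true; false; _∧_; _∨_; not; if_then_else_)
open import Data.Bool.Properties using (T-≡; ∧-identityʳ; ∧-zeroʳ; ∨-comm; ∨-identityʳ; ∨-zeroʳ)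
open import Data.List using (List; []; _∷_; [_]; _++_; drop; foldr; length; map; reverse; take)
open import Data.List.Membership.Propositional using (_∈_; lose)
open import Data.List.Membership.Propositional.Properties using (∈-++⁺ˡ; ∈-++⁺ʳ; ∈-++⁻; ∈-concat⁺′; ∈-map⁺; ∈-map⁻; ∈-upTo⁺)
open import Data.List.Properties using (foldr-preservesᵇ; foldr-preservesᵒ; length-reverse; reverse-involutive; unfold-reverse)
open import Data.List.Relation.Binary.Sublist.Propositional using (_⊆_; []; _∷_; _∷ʳ_; minimum)
open import Data.List.Relation.Binary.Sublist.Propositional.Properties using (All-resp-⊆; reverse⁺)
open import Data.List.Relation.Unary.All as All using (All; []; _∷_)
open import Data.List.Relation.Unary.AllPairs using (AllPairs; []; _∷_)
import Data.List.Relation.Unary.AllPairs.Properties as AllPairsₚ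
open import Data.List.Relation.Unary.Any using (here)
import Data.List.Relation.Unary.Any.Properties as Anyₚ
open import Data.Nat using (ℕ; zero; suc; _+_; _∸_; _⊓_; _⊔_; _≤_; _<_; _>_; z≤n; s≤s; _≡ᵇ_; _<ᵇ_)
open import Data.Nat.Properties
open import Data.Nat.Tactic.RingSolver using (solve-∀)
open import Data.Product using (_×_; _,_; proj₁; proj₂; ∃-syntax)
open import Data.Sum as Sum using (_⊎_; inj₁; inj₂)
open import Data.Vec using (Vec; toList)
open import Data.Vec.Properties using (length-toList)
open import Function using (Equivalence; case_of_; flip)
open import Relation.Binary.PropositionalEquality hiding ([_])
open import Relation.Nullary using (contradiction; no; yes)

-- Boolean tests and the propositions they decide.

≡ᵇ-sound : ∀ {m n} → (m ≡ᵇ n) ≡ true → m ≡ n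
≡ᵇ-sound {m} {n} p = ≡ᵇ⇒≡ m n (Equivalence.from T-≡ p)

≡ᵇ-true : ∀ {m n} → m ≡ n → (m ≡ᵇ n) ≡ true
≡ᵇ-true {m} {n} m≡n = Equivalence.to T-≡ (≡⇒≡ᵇ m n m≡n)

≡ᵇ-false : ∀ {m n} → m ≢ n → (m ≡ᵇ n) ≡ false
≡ᵇ-false {m} {n} m≢n with m ≡ᵇ n in eq
... | true  = contradiction (≡ᵇ-sound eq) m≢n
... | false = refl

<ᵇ-true⁻ : ∀ {m n} → (m <ᵇ n) ≡ true → m < n
<ᵇ-true⁻ {m} {n} p = <ᵇ⇒< m n (Equivalence.from T-≡ p)

<ᵇ-true⁺ : ∀ {m n} → m < n → (m <ᵇ n) ≡ true
<ᵇ-true⁺ m<n = Equivalence.to T-≡ (<⇒<ᵇ m<n)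

<ᵇ-false : ∀ {m n} → n ≤ m → (m <ᵇ n) ≡ false
<ᵇ-false {m} {n} n≤m with m <ᵇ n in eq
... | true  = contradiction (<ᵇ-true⁻ {m} eq) (≤⇒≯ n≤m)
... | false = refl

if-true : ∀ {A : Set} {b} {x y : A} → b ≡ true → (if b then x else y) ≡ x
if-true refl = refl

if-false : ∀ {A : Set} {b} {x y : A} → b ≡ false → (if b then x else y) ≡ y
if-false refl = refl

true-⇔ : ∀ {a b} → (a ≡ true → b ≡ true) → (b ≡ true → a ≡ true) → a ≡ b
true-⇔ {true}  {b} f g = sym (f refl)
true-⇔ {false} {true} f g = g refl
true-⇔ {false} {false} f g = refl

∧-true : ∀ {a b} → a ∧ b ≡ true → a ≡ true × b ≡ true
∧-true {true} {true} refl = refl , refl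

true-or-false : ∀ b → b ≡ true ⊎ b ≡ false
true-or-false true  = inj₁ refl
true-or-false false = inj₂ refl

-- Lattice paths in the rows of a tableau

bit : Bool → ℕ
bit true  = 1
bit false = 0

Bits : Set
Bits = ℕ → Bool

-- A tableau is encoded by ρ : ℕ → Bits, where ρ k f tells whether n ∸ f occurs in
-- row k + 1; the value n marks an antidiagonal box that has not received its
-- letter.  Thus count (ρ k) f is the number of entries ≥ n ∸ f in that row, and
-- cost ρ s k f is the least cost of a path from row k + 1 and value n ∸ f that
-- uses s + 1 rows.
count : Bits → ℕ → ℕ
count τ zero    = bit (τ 0)
count τ (suc f) = bit (τ (suc f)) + count τ f

walk : Bits → (ℕ → ℕ) → ℕ → ℕ
-- At value `n` another row is available, and changing to it ends the path for free.
walk τ t zero    = 0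
walk τ t (suc f) = (bit (τ (suc f)) + walk τ t f) ⊓ t f

cost : (ℕ → Bits) → ℕ → ℕ → ℕ → ℕ
cost ρ zero    k = count (ρ k)
cost ρ (suc s) k = walk (ρ k) (cost ρ s (suc k))

-- This is strictness down columns. Rows end at the antidiagonal, so below a box at distance δ + 1
-- from it lies a box at distance δ; if the upper one holds at least `n ∸ suc f`, the lower one
-- holds at least `n ∸ f`.
Interlaced : (ℕ → Bits) → Set
Interlaced ρ = ∀ k f → count (ρ k) (suc f) ≤ suc (count (ρ (suc k)) f)

bit≤1 : ∀ b → bit b ≤ 1
bit≤1 true  = s≤s z≤n
bit≤1 false = z≤n

module _ (ρ : ℕ → Bits) where

  cost-stay : ∀ s k f → cost ρ s k (suc f) ≤ bit (ρ k (suc f)) + cost ρ s k f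
  cost-stay zero    k f = ≤-refl
  cost-stay (suc s) k f = m⊓n≤m _ _

  cost-drop : ∀ s k f → cost ρ (suc s) k (suc f) ≤ cost ρ s (suc k) f
  cost-drop s k f = m⊓n≤n _ _

  cost-zero : ∀ s k → cost ρ s k 0 ≤ count (ρ k) 0
  cost-zero zero    k = ≤-refl
  cost-zero (suc s) k = z≤n

  -- There are enough rows for each of the `suc f` passages to be a free change of row.
  cost-diagonal : ∀ k f → cost ρ (suc f) k f ≡ 0
  cost-diagonal k zero    = refl
  cost-diagonal k (suc f) = n≤0⇒n≡0 (≤-trans (cost-drop (suc f) k f) (≤-reflexive (cost-diagonal (suc k) f)))

  module _ (inter : Interlaced ρ) where

    -- The shorter path copies the longer one until the latter enters its last row; there it stays
    -- behind, and `inter` says that the rest of its row costs at most one unit more.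
    cost-suc : ∀ s k f → cost ρ s k f ≤ suc (cost ρ (suc s) k f)
    cost-suc s k zero = ≤-trans (cost-zero s k) (bit≤1 (ρ k 0))
    cost-suc s k (suc f) = ⊓-glb stay (descend s)
      where
      stay : cost ρ s k (suc f) ≤ suc (bit (ρ k (suc f)) + cost ρ (suc s) k f)
      stay = ≤-trans (cost-stay s k f)
        (≤-trans (+-monoʳ-≤ (bit (ρ k (suc f))) (cost-suc s k f)) (≤-reflexive (+-suc _ _)))
      descend : ∀ s → cost ρ s k (suc f) ≤ suc (cost ρ s (suc k) f)
      descend zero     = inter k f
      descend (suc s′) = ≤-trans (cost-drop s′ k f) (cost-suc s′ (suc k) f)

    -- Used in the tight case `count (ρ k) f ≡ suc (count (ρ (suc k)) f)`, where a path may start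
    -- one row lower without loss. While the upper path stays in its row, the lower one stays too,
    -- and what each pays is matched by the counts; when the upper path changes rows, `inter` closes
    -- the gap.
    cost-shift : ∀ s k f → cost ρ s (suc k) f + count (ρ k) f ≤ cost ρ (suc s) k f + suc (count (ρ (suc k)) f)
    cost-shift s k zero = begin
      cost ρ s (suc k) 0 + count (ρ k) 0 ≤⟨ +-mono-≤ (cost-zero s (suc k)) (bit≤1 (ρ k 0)) ⟩
      count (ρ (suc k)) 0 + 1            ≡⟨ +-comm _ 1 ⟩
      suc (count (ρ (suc k)) 0) ∎
      where open ≤-Reasoning
    cost-shift s k (suc f) with ⊓-sel (bit (ρ k (suc f)) + cost ρ (suc s) k f) (cost ρ s (suc k) f)
    ... | inj₁ eq rewrite eq = begin
      cost ρ s (suc k) (suc f) + (b₁ + n₁)        ≤⟨ +-monoˡ-≤ (b₁ + n₁) (cost-stay s (suc k) f) ⟩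
      b₂ + cost ρ s (suc k) f + (b₁ + n₁)         ≡⟨ shuffle b₂ (cost ρ s (suc k) f) b₁ n₁ ⟩
      (b₂ + b₁) + (cost ρ s (suc k) f + n₁)       ≤⟨ +-monoʳ-≤ (b₂ + b₁) (cost-shift s k f) ⟩
      (b₂ + b₁) + (cost ρ (suc s) k f + suc n₂)   ≡⟨ shuffle′ b₂ b₁ (cost ρ (suc s) k f) n₂ ⟩
      b₁ + cost ρ (suc s) k f + suc (b₂ + n₂) ∎
      where
      open ≤-Reasoning
      b₁ = bit (ρ k (suc f))
      b₂ = bit (ρ (suc k) (suc f))
      n₁ = count (ρ k) f
      n₂ = count (ρ (suc k)) f
      shuffle : ∀ b₂ c b₁ n₁ → b₂ + c + (b₁ + n₁) ≡ (b₂ + b₁) + (c + n₁)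
      shuffle = solve-∀
      shuffle′ : ∀ b₂ b₁ c n₂ → (b₂ + b₁) + (c + suc n₂) ≡ b₁ + c + suc (b₂ + n₂)
      shuffle′ = solve-∀
    ... | inj₂ eq rewrite eq = begin
      cost ρ s (suc k) (suc f) + count (ρ k) (suc f) ≤⟨ +-mono-≤ (cost-stay s (suc k) f) (inter k f) ⟩
      b₂ + cost ρ s (suc k) f + suc n₂               ≡⟨ shuffle b₂ (cost ρ s (suc k) f) n₂ ⟩
      cost ρ s (suc k) f + suc (b₂ + n₂) ∎
      where
      open ≤-Reasoning
      b₂ = bit (ρ (suc k) (suc f))
      n₂ = count (ρ (suc k)) f
      shuffle : ∀ b₂ c n₂ → b₂ + c + suc n₂ ≡ c + suc (b₂ + n₂)
      shuffle = solve-∀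

-- One slide of dots through the rows, and its effect on the cost.

-- `e f` tells whether the row holds a dot once the values from `n ∸ f` up have moved. At the next
-- value a dot that stays lets an entry pass sideways, a dot that appears takes the entry out of the
-- row, and a dot that disappears leaves an entry behind.
remove : Bits → Bits → Bits
remove τ e zero    = τ 0 ∧ not (e 0)
remove τ e (suc f) = if τ (suc f) then e f ∨ not (e (suc f)) else e f ∧ not (e (suc f))

record Removable (τ e : Bits) : Set where
  field
    initial : e 0 ≡ true → τ 0 ≡ true
    persist : ∀ f → τ (suc f) ≡ true → e f ≡ true → e (suc f) ≡ true
    settled : ∀ f → τ (suc f) ≡ false → e (suc f) ≡ true → e f ≡ true

module _ {τ e : Bits} (rem : Removable τ e) where
  open Removable rem

  -- `persist` and `settled` exclude exactly the two cases in which entries and dots would not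
  -- balance: a dot vanishing although its row has the entry, and a dot appearing although it has
  -- not.
  remove-bit : ∀ f → bit (τ (suc f)) + bit (e f) ≡ bit (e (suc f)) + bit (remove τ e (suc f))
  remove-bit f with τ (suc f) in τf | e f in ef | e (suc f) in esf
  ... | true  | true  | true  = refl
  ... | true  | true  | false = case trans (sym esf) (persist f τf ef) of λ ()
  ... | true  | false | true  = refl
  ... | true  | false | false = refl
  ... | false | true  | true  = refl
  ... | false | true  | false = refl
  ... | false | false | true  = case trans (sym ef) (settled f τf esf) of λ ()
  ... | false | false | false = refl

  remove-count : ∀ f → count τ f ≡ bit (e f) + count (remove τ e) f
  remove-count zero with e 0 in e0 | τ 0 in τ0
  ... | true  | true  = refl
  ... | true  | false = case trans (sym τ0) (initial e0) of λ ()
  ... | false | true  = refl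
  ... | false | false = refl
  remove-count (suc f) = begin
    bit (τ (suc f)) + count τ f                              ≡⟨ cong (bit (τ (suc f)) +_) (remove-count f) ⟩
    bit (τ (suc f)) + (bit (e f) + count (remove τ e) f)     ≡⟨ +-assoc (bit (τ (suc f))) _ _ ⟨
    bit (τ (suc f)) + bit (e f) + count (remove τ e) f       ≡⟨ cong (_+ count (remove τ e) f) (remove-bit f) ⟩
    bit (e (suc f)) + bit (remove τ e (suc f)) + count (remove τ e) f ≡⟨ +-assoc (bit (e (suc f))) _ _ ⟩
    bit (e (suc f)) + count (remove τ e) (suc f) ∎
    where open ≡-Reasoning

module Slide (ρ : ℕ → Bits) (C : Bits) where

  -- push k f: the dot below the entry n ∸ suc f of row k + 1, if there is one,
  -- changes places with that entry.
  opaque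
    push : ℕ → ℕ → Bool
    push k f = ρ k (suc f) ∧ (count (ρ k) (suc f) ≡ᵇ suc (count (ρ (suc k)) f))

    push-def : ∀ k f → push k f ≡ ρ k (suc f) ∧ (count (ρ k) (suc f) ≡ᵇ suc (count (ρ (suc k)) f))
    push-def k f = refl

  blocked : ℕ → ℕ → Bool
  blocked zero    f = false
  blocked (suc k) f = push k f

  -- An entry of the row moves right into a dot of its row or down into a dot of the next row, or
  -- both, and leaves a single dot. If the row lacks the entry, its dot stays unless the box above
  -- it holds the entry, which then comes down.
  dot : ℕ → Bits
  dot k zero    = C k
  dot k (suc f) = if ρ k (suc f) then dot k f ∨ (dot (suc k) f ∧ push k f) else dot k f ∧ not (blocked k f)

  -- The dots of row k + 1 if the row above it were absent, so that none of them is lost.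
  free : ℕ → Bits
  free k zero    = C k
  free k (suc f) = dot (suc k) f ∧ push k f ∨ free k f

  ρ′ : ℕ → Bits
  ρ′ k = remove (ρ k) (dot k)

  ρᶠ : ℕ → Bits
  ρᶠ k = remove (ρ k) (free k)

  -- A hybrid in which only the first row of the path uses `ρᶠ`. It permits an induction adding rows
  -- from bottom to top, each of them being the top row for a moment.
  costᶠ : ℕ → ℕ → ℕ → ℕ
  costᶠ zero    k = count (ρᶠ k)
  costᶠ (suc s) k = walk (ρᶠ k) (cost ρ′ s (suc k))

  push-bit : ∀ k f → push k f ≡ true → ρ k (suc f) ≡ true
  push-bit k f p = proj₁ (∧-true (trans (sym (push-def k f)) p))

  push-count : ∀ k f → push k f ≡ true → count (ρ k) (suc f) ≡ suc (count (ρ (suc k)) f)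
  push-count k f p = ≡ᵇ-sound (proj₂ (∧-true {ρ k (suc f)} (trans (sym (push-def k f)) p)))

  push-false : ∀ k f → ρ k (suc f) ≡ false → push k f ≡ false
  push-false k f r = trans (push-def k f) (cong (_∧ (count (ρ k) (suc f) ≡ᵇ suc (count (ρ (suc k)) f))) r)

  dot-pushed : ∀ k f → dot (suc k) f ≡ true → push k f ≡ true → dot k (suc f) ≡ true
  dot-pushed k f d p rewrite push-bit k f p | d | p = ∨-zeroʳ (dot k f)

  free-pushed : ∀ k f → dot (suc k) f ≡ true → push k f ≡ true → free k (suc f) ≡ true
  free-pushed k f d p rewrite d | p = refl

  dot-kept : ∀ k f → ρ k (suc f) ≡ false → dot k f ≡ true → blocked k f ≡ false → dot k (suc f) ≡ true
  dot-kept k f r d b rewrite r | d | b = refl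

  free-mono : ∀ k f → free k f ≡ true → free k (suc f) ≡ true
  free-mono k f e rewrite e = ∨-zeroʳ _

  free-new : ∀ k f → free k (suc f) ≡ true → free k f ≡ false → dot (suc k) f ≡ true × push k f ≡ true
  free-new k f e n rewrite n = ∧-true (trans (sym (∨-identityʳ _)) e)

  dot⇒free : ∀ k f → dot k f ≡ true → free k f ≡ true
  dot⇒free k zero    d = d
  dot⇒free k (suc f) d with ρ k (suc f) | dot k f in df | dot (suc k) f | push k f
  ... | true  | true  | _     | _     rewrite dot⇒free k f df = ∨-zeroʳ _
  ... | true  | false | true  | true  = refl
  ... | false | true  | _     | _     rewrite dot⇒free k f df = ∨-zeroʳ _

  -- Row 1 has nothing above it that could take a dot away. Hence bounds on `costᶠ` from row 1 are
  -- bounds on `cost ρ′`.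
  free≡dot : ∀ f → free 0 f ≡ dot 0 f
  free≡dot zero = refl
  free≡dot (suc f) rewrite free≡dot f with ρ 0 (suc f) in r
  ... | true  = ∨-comm (dot 1 f ∧ push 0 f) (dot 0 f)
  ... | false rewrite push-false 0 f r | ∧-zeroʳ (dot 1 f) = sym (∧-identityʳ (dot 0 f))

  module _ (C⊆ : ∀ k → C k ≡ true → ρ k 0 ≡ true) where

    dot-removable : ∀ k → Removable (ρ k) (dot k)
    dot-removable k = record { initial = C⊆ k ; persist = p ; settled = s }
      where
      p : ∀ f → ρ k (suc f) ≡ true → dot k f ≡ true → dot k (suc f) ≡ true
      p f r d rewrite r | d = refl
      s : ∀ f → ρ k (suc f) ≡ false → dot k (suc f) ≡ true → dot k f ≡ true
      s f r d rewrite r = proj₁ (∧-true d)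

    free-removable : ∀ k → Removable (ρ k) (free k)
    free-removable k = record { initial = C⊆ k ; persist = λ f _ → free-mono k f ; settled = s }
      where
      s : ∀ f → ρ k (suc f) ≡ false → free k (suc f) ≡ true → free k f ≡ true
      s f r e with free k f | free-new k f e
      ... | true  | _   = refl
      ... | false | new = case trans (sym (push-bit k f (proj₂ (new refl)))) r of λ ()

    dot-count : ∀ k f → count (ρ k) f ≡ bit (dot k f) + count (ρ′ k) f
    dot-count k = remove-count (dot-removable k)

    dot-bit : ∀ k f → bit (ρ k (suc f)) + bit (dot k f) ≡ bit (dot k (suc f)) + bit (ρ′ k (suc f))
    dot-bit k = remove-bit (dot-removable k)

    free-bit : ∀ k f → bit (ρ k (suc f)) + bit (free k f) ≡ bit (free k (suc f)) + bit (ρᶠ k (suc f))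
    free-bit k = remove-bit (free-removable k)

    bit-mono : ∀ {a b} → (a ≡ true → b ≡ true) → bit a ≤ bit b
    bit-mono {true}  {b} h rewrite h refl = ≤-refl
    bit-mono {false} h = z≤n

    ρᶠ≤ρ : ∀ k f → bit (ρᶠ k (suc f)) ≤ bit (ρ k (suc f))
    ρᶠ≤ρ k f = +-cancelˡ-≤ (bit (free k f)) _ _ (begin
      bit (free k f) + bit (ρᶠ k (suc f))       ≤⟨ +-monoˡ-≤ _ (bit-mono (free-mono k f)) ⟩
      bit (free k (suc f)) + bit (ρᶠ k (suc f)) ≡⟨ free-bit k f ⟨
      bit (ρ k (suc f)) + bit (free k f)        ≡⟨ +-comm (bit (ρ k (suc f))) _ ⟩
      bit (free k f) + bit (ρ k (suc f)) ∎)
      where open ≤-Reasoning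

    ρᶠ≡ρ : ∀ k f → free k f ≡ true → bit (ρᶠ k (suc f)) ≡ bit (ρ k (suc f))
    ρᶠ≡ρ k f e = sym (+-cancelʳ-≡ 1 _ _ (begin
      bit (ρ k (suc f)) + 1                     ≡⟨ cong (λ b → bit (ρ k (suc f)) + bit b) e ⟨
      bit (ρ k (suc f)) + bit (free k f)        ≡⟨ free-bit k f ⟩
      bit (free k (suc f)) + bit (ρᶠ k (suc f)) ≡⟨ cong (λ b → bit b + bit (ρᶠ k (suc f))) (free-mono k f e) ⟩
      1 + bit (ρᶠ k (suc f))                    ≡⟨ +-comm 1 _ ⟩
      bit (ρᶠ k (suc f)) + 1 ∎))
      where open ≡-Reasoning

    ρ′≡ρ : ∀ k f → dot k f ≡ false → dot k (suc f) ≡ false → bit (ρ′ k (suc f)) ≡ bit (ρ k (suc f))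
    ρ′≡ρ k f d d′ with eq ← dot-bit k f rewrite d | d′ = sym (trans (sym (+-identityʳ _)) eq)

    -- While the path stays in its row, both sides grow by the same bit of `ρ`, by `dot-bit` and
    -- `free-bit`. After a change of row both continue in `ρ′`, and `dot⇒free` suffices.
    cost′≤costᶠ : ∀ s k f → cost ρ′ s k f + bit (dot k f) ≤ costᶠ s k f + bit (free k f)
    cost′≤costᶠ zero k f = ≤-reflexive (begin
      count (ρ′ k) f + bit (dot k f)  ≡⟨ +-comm (count (ρ′ k) f) _ ⟩
      bit (dot k f) + count (ρ′ k) f  ≡⟨ dot-count k f ⟨
      count (ρ k) f                   ≡⟨ remove-count (free-removable k) f ⟩
      bit (free k f) + count (ρᶠ k) f ≡⟨ +-comm (bit (free k f)) _ ⟩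
      count (ρᶠ k) f + bit (free k f) ∎)
      where open ≡-Reasoning
    cost′≤costᶠ (suc s) k zero = ≤-refl
    cost′≤costᶠ (suc s) k (suc f) with ⊓-sel (bit (ρᶠ k (suc f)) + costᶠ (suc s) k f) (cost ρ′ s (suc k) f)
    ... | inj₂ eq rewrite eq = +-mono-≤ (cost-drop ρ′ s k f) (bit-mono (dot⇒free k (suc f)))
    ... | inj₁ eq rewrite eq = begin
      cost ρ′ (suc s) k (suc f) + bit (dot k (suc f))
        ≤⟨ +-monoˡ-≤ _ (cost-stay ρ′ (suc s) k f) ⟩
      bit (ρ′ k (suc f)) + cost ρ′ (suc s) k f + bit (dot k (suc f))
        ≡⟨ swap (bit (ρ′ k (suc f))) _ _ ⟩
      bit (dot k (suc f)) + bit (ρ′ k (suc f)) + cost ρ′ (suc s) k f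
        ≡⟨ cong (_+ cost ρ′ (suc s) k f) (dot-bit k f) ⟨
      bit (ρ k (suc f)) + bit (dot k f) + cost ρ′ (suc s) k f
        ≡⟨ swap′ (bit (ρ k (suc f))) _ _ ⟩
      bit (ρ k (suc f)) + (cost ρ′ (suc s) k f + bit (dot k f))
        ≤⟨ +-monoʳ-≤ (bit (ρ k (suc f))) (cost′≤costᶠ (suc s) k f) ⟩
      bit (ρ k (suc f)) + (costᶠ (suc s) k f + bit (free k f))
        ≡⟨ swap′ (bit (ρ k (suc f))) _ _ ⟨
      bit (ρ k (suc f)) + bit (free k f) + costᶠ (suc s) k f
        ≡⟨ cong (_+ costᶠ (suc s) k f) (free-bit k f) ⟩
      bit (free k (suc f)) + bit (ρᶠ k (suc f)) + costᶠ (suc s) k f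
        ≡⟨ swap (bit (ρᶠ k (suc f))) _ _ ⟨
      bit (ρᶠ k (suc f)) + costᶠ (suc s) k f + bit (free k (suc f)) ∎
      where
      open ≤-Reasoning
      swap : ∀ a b c → a + b + c ≡ c + a + b
      swap = solve-∀
      swap′ : ∀ a b c → a + b + c ≡ a + (c + b)
      swap′ = solve-∀

    cost′≤costᶠ-dotted : ∀ s k f → dot k f ≡ free k f → cost ρ′ s k f ≤ costᶠ s k f
    cost′≤costᶠ-dotted s k f eq = +-cancelʳ-≤ (bit (dot k f)) _ _
      (≤-trans (cost′≤costᶠ s k f) (≤-reflexive (cong (λ b → costᶠ s k f + bit b) (sym eq))))

    costᶠ-cases : ∀ s k f → costᶠ s k (suc f) ≡ bit (ρᶠ k (suc f)) + costᶠ s k f ⊎ cost ρ′ s k (suc f) ≤ costᶠ s k (suc f)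
    costᶠ-cases zero    k f = inj₁ refl
    costᶠ-cases (suc s) k f with ⊓-sel (bit (ρᶠ k (suc f)) + costᶠ (suc s) k f) (cost ρ′ s (suc k) f)
    ... | inj₁ eq = inj₁ eq
    ... | inj₂ eq = inj₂ (≤-trans (cost-drop ρ′ s k f) (≤-reflexive (sym eq)))

    module _ (inter : Interlaced ρ) where

      -- When row k + 2 has lost a dot, the dot went to row k + 1, and a path may follow
      -- it there instead of entering row k + 2 right away.
      lost-dot : ∀ s k f → free (suc k) f ≡ true → dot (suc k) f ≡ false →
        free k f ≡ true ×
        (cost ρ′ s (suc k) f ≤ costᶠ s (suc k) f ⊎
         costᶠ (suc s) k f + suc (count (ρ (suc k)) f) ≤ costᶠ s (suc k) f + count (ρ k) f)
      lost-dot s k zero    e d = case trans (sym d) e of λ ()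
      lost-dot s k (suc f) e d with true-or-false (dot (suc k) f) | true-or-false (free (suc k) f)
      ... | inj₂ df | inj₂ ef = case trans (sym d) (let a , b = free-new (suc k) f e ef in dot-pushed (suc k) f a b) of λ ()
      ... | inj₁ df | inj₂ ef = case trans (sym ef) (dot⇒free (suc k) f df) of λ ()
      -- The dot was lost at a larger value. At the present value `ρᶠ` agrees with `ρ` in both rows,
      -- so either alternative survives a step in which the path stays in row k + 2.
      ... | inj₂ df | inj₁ ef with lost-dot s k f ef df
      ...   | efk , alt = free-mono k f efk , go (costᶠ-cases s (suc k) f) alt
        where
        open ≤-Reasoning
        go : costᶠ s (suc k) (suc f) ≡ bit (ρᶠ (suc k) (suc f)) + costᶠ s (suc k) f ⊎ cost ρ′ s (suc k) (suc f) ≤ costᶠ s (suc k) (suc f) →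
             cost ρ′ s (suc k) f ≤ costᶠ s (suc k) f ⊎ costᶠ (suc s) k f + suc (count (ρ (suc k)) f) ≤ costᶠ s (suc k) f + count (ρ k) f →
             cost ρ′ s (suc k) (suc f) ≤ costᶠ s (suc k) (suc f) ⊎
             costᶠ (suc s) k (suc f) + suc (count (ρ (suc k)) (suc f)) ≤ costᶠ s (suc k) (suc f) + count (ρ k) (suc f)
        go (inj₂ le) _ = inj₁ le
        go (inj₁ eq) (inj₁ le) = inj₁ (begin
          cost ρ′ s (suc k) (suc f)                        ≤⟨ cost-stay ρ′ s (suc k) f ⟩
          bit (ρ′ (suc k) (suc f)) + cost ρ′ s (suc k) f   ≡⟨ cong (_+ cost ρ′ s (suc k) f) (trans (ρ′≡ρ (suc k) f df d) (sym (ρᶠ≡ρ (suc k) f ef))) ⟩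
          bit (ρᶠ (suc k) (suc f)) + cost ρ′ s (suc k) f   ≤⟨ +-monoʳ-≤ (bit (ρᶠ (suc k) (suc f))) le ⟩
          bit (ρᶠ (suc k) (suc f)) + costᶠ s (suc k) f     ≡⟨ eq ⟨
          costᶠ s (suc k) (suc f) ∎)
        go (inj₁ eq) (inj₂ le) = inj₂ (begin
          costᶠ (suc s) k (suc f) + suc (b₂ + n₂)          ≤⟨ +-monoˡ-≤ (suc (b₂ + n₂)) (m⊓n≤m _ _) ⟩
          bit (ρᶠ k (suc f)) + costᶠ (suc s) k f + suc (b₂ + n₂) ≡⟨ cong (λ b → b + costᶠ (suc s) k f + suc (b₂ + n₂)) (ρᶠ≡ρ k f efk) ⟩
          b₁ + costᶠ (suc s) k f + suc (b₂ + n₂)           ≡⟨ swap b₁ (costᶠ (suc s) k f) b₂ n₂ ⟩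
          (b₁ + b₂) + (costᶠ (suc s) k f + suc n₂)         ≤⟨ +-monoʳ-≤ (b₁ + b₂) le ⟩
          (b₁ + b₂) + (costᶠ s (suc k) f + n₁)             ≡⟨ swap′ b₁ b₂ (costᶠ s (suc k) f) n₁ ⟩
          b₂ + costᶠ s (suc k) f + (b₁ + n₁)               ≡⟨ cong (λ b → b + costᶠ s (suc k) f + (b₁ + n₁)) (ρᶠ≡ρ (suc k) f ef) ⟨
          bit (ρᶠ (suc k) (suc f)) + costᶠ s (suc k) f + (b₁ + n₁) ≡⟨ cong (_+ (b₁ + n₁)) eq ⟨
          costᶠ s (suc k) (suc f) + (b₁ + n₁) ∎)
          where
          b₁ = bit (ρ k (suc f))
          b₂ = bit (ρ (suc k) (suc f))
          n₁ = count (ρ k) f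
          n₂ = count (ρ (suc k)) f
          swap : ∀ b₁ v b₂ n₂ → b₁ + v + suc (b₂ + n₂) ≡ (b₁ + b₂) + (v + suc n₂)
          swap = solve-∀
          swap′ : ∀ b₁ b₂ c n₁ → (b₁ + b₂) + (c + n₁) ≡ b₂ + c + (b₁ + n₁)
          swap′ = solve-∀
      -- The dot is lost at this very value: row k + 2 lacks the entry, and the one above the dot
      -- comes down. The dot thereby reaches row k + 1, and `push-count` provides the tight count.
      lost-dot s k (suc f) e d | inj₁ df | inj₁ ef with true-or-false (ρ (suc k) (suc f)) | true-or-false (push k f)
      ... | inj₁ r | _      = case trans (sym d) (Removable.persist (dot-removable (suc k)) f r df) of λ ()
      ... | inj₂ r | inj₂ p = case trans (sym d) (dot-kept (suc k) f r df p) of λ ()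
      ... | inj₂ r | inj₁ p with costᶠ-cases s (suc k) f
      ...   | inj₂ le = free-pushed k f df p , inj₁ le
      ...   | inj₁ eq = free-pushed k f df p , inj₂ (begin
        costᶠ (suc s) k (suc f) + suc (bit (ρ (suc k) (suc f)) + count (ρ (suc k)) f)
          ≡⟨ cong (λ b → costᶠ (suc s) k (suc f) + suc (bit b + count (ρ (suc k)) f)) r ⟩
        costᶠ (suc s) k (suc f) + suc (count (ρ (suc k)) f)
          ≤⟨ +-mono-≤ (m⊓n≤n _ _) (≤-reflexive (sym (push-count k f p))) ⟩
        cost ρ′ s (suc k) f + count (ρ k) (suc f)
          ≤⟨ +-monoˡ-≤ (count (ρ k) (suc f)) (cost′≤costᶠ-dotted s (suc k) f (trans df (sym ef))) ⟩
        costᶠ s (suc k) f + count (ρ k) (suc f)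
          ≤⟨ +-monoˡ-≤ (count (ρ k) (suc f)) (m≤n+m _ (bit (ρᶠ (suc k) (suc f)))) ⟩
        bit (ρᶠ (suc k) (suc f)) + costᶠ s (suc k) f + count (ρ k) (suc f)
          ≡⟨ cong (_+ count (ρ k) (suc f)) eq ⟨
        costᶠ s (suc k) (suc f) + count (ρ k) (suc f) ∎)
        where open ≤-Reasoning

      -- A path of `ρ` is imitated; only entering row k + 2 is delicate, because there `costᶠ` has
      -- to replace `cost ρ′`. If that row has lost its dot, either the replacement is still valid
      -- or, by `lost-dot` and interlacing, staying in row k + 1 is as good.
      costᶠ-step : ∀ s k {κ} → (∀ f → costᶠ s (suc k) f ≤ κ f) → ∀ f → costᶠ (suc s) k f ≤ walk (ρ k) κ f
      costᶠ-step s k le zero    = z≤n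
      costᶠ-step s k {κ} le (suc f) = ⊓-glb
        (≤-trans (m⊓n≤m _ _) (+-mono-≤ (ρᶠ≤ρ k f) (costᶠ-step s k le f)))
        (≤-trans descend (le f))
        where
        open ≤-Reasoning
        N = costᶠ s (suc k) f
        descend : costᶠ (suc s) k (suc f) ≤ costᶠ s (suc k) f
        descend with true-or-false (dot (suc k) f) | true-or-false (free (suc k) f)
        ... | inj₁ d | _      = ≤-trans (m⊓n≤n _ _) (cost′≤costᶠ-dotted s (suc k) f (trans d (sym (dot⇒free (suc k) f d))))
        ... | inj₂ d | inj₂ e = ≤-trans (m⊓n≤n _ _) (cost′≤costᶠ-dotted s (suc k) f (trans d (sym e)))
        ... | inj₂ d | inj₁ e with lost-dot s k f e d
        ...   | _   , inj₁ le′ = ≤-trans (m⊓n≤n _ _) le′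
        ...   | efk , inj₂ le′ = +-cancelʳ-≤ (suc n₂) _ _ (begin
          costᶠ (suc s) k (suc f) + suc n₂                       ≤⟨ +-monoˡ-≤ (suc n₂) (m⊓n≤m _ _) ⟩
          bit (ρᶠ k (suc f)) + costᶠ (suc s) k f + suc n₂        ≤⟨ +-monoˡ-≤ (suc n₂) (+-monoˡ-≤ _ (ρᶠ≤ρ k f)) ⟩
          bit (ρ k (suc f)) + costᶠ (suc s) k f + suc n₂         ≡⟨ +-assoc (bit (ρ k (suc f))) _ _ ⟩
          bit (ρ k (suc f)) + (costᶠ (suc s) k f + suc n₂)       ≤⟨ +-monoʳ-≤ (bit (ρ k (suc f))) le′ ⟩
          bit (ρ k (suc f)) + (N + count (ρ k) f)                ≡⟨ shuffle (bit (ρ k (suc f))) N _ ⟩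
          N + count (ρ k) (suc f)                                ≤⟨ +-monoʳ-≤ N (inter k f) ⟩
          N + suc n₂ ∎)
          where
          n₂ = count (ρ (suc k)) f
          shuffle : ∀ a b c → a + (b + c) ≡ b + (a + c)
          shuffle = solve-∀

      free-count : ∀ k f → count (ρ k) f ≡ bit (free k f) + count (ρᶠ k) f
      free-count k = remove-count (free-removable k)

      costᶠ≤cost : ∀ s k f → costᶠ s k f ≤ cost ρ s k f
      costᶠ≤cost zero    k f = ≤-trans (m≤n+m _ (bit (free k f))) (≤-reflexive (sym (free-count k f)))
      costᶠ≤cost (suc s) k   = costᶠ-step s k (costᶠ≤cost s (suc k))

      free-C : ∀ k f → C k ≡ true → free k f ≡ true
      free-C k zero    c = c
      free-C k (suc f) c = free-mono k f (free-C k f c)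

      -- A dot starting in the last row stays free and lowers every count there by one, which is all
      -- that an additional row could save.
      costᶠ≤cost-suc : ∀ s k f → C (s + k) ≡ true → costᶠ s k f ≤ cost ρ (suc s) k f
      costᶠ≤cost-suc zero    k f c = ≤-pred (begin
        suc (count (ρᶠ k) f)            ≡⟨ cong (λ b → bit b + count (ρᶠ k) f) (free-C k f c) ⟨
        bit (free k f) + count (ρᶠ k) f ≡⟨ free-count k f ⟨
        count (ρ k) f                   ≤⟨ cost-suc ρ inter 0 k f ⟩
        suc (cost ρ 1 k f) ∎)
        where open ≤-Reasoning
      costᶠ≤cost-suc (suc s) k f c = costᶠ-step s k (λ g → costᶠ≤cost-suc s (suc k) g (trans (cong C (+-suc s k)) c)) f

      cost′-upper : ∀ s f → cost ρ′ s 0 f ≤ cost ρ s 0 f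
      cost′-upper s f = ≤-trans (cost′≤costᶠ-dotted s 0 f (sym (free≡dot f))) (costᶠ≤cost s 0 f)

      cost′-upper-C : ∀ s f → C s ≡ true → cost ρ′ s 0 f ≤ cost ρ (suc s) 0 f
      cost′-upper-C s f c = ≤-trans (cost′≤costᶠ-dotted s 0 f (sym (free≡dot f)))
        (costᶠ≤cost-suc s 0 f (trans (cong C (+-identityʳ s)) c))

      push-tight : ∀ k f → ρ k (suc f) ≡ true → push k f ≡ false → count (ρ k) (suc f) ≤ count (ρ (suc k)) f
      push-tight k f r p = ≤-pred (≤∧≢⇒< (inter k f) λ eq →
        case trans (sym (trans (push-def k f) (cong₂ _∧_ r (≡ᵇ-true eq)))) p of λ ())

      count-false : ∀ k f → ρ k (suc f) ≡ false → count (ρ k) (suc f) ≡ count (ρ k) f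
      count-false k f r = cong (λ b → bit b + count (ρ k) f) r

      -- Two reasons concern the box above the dot: column strictness, if row k + 2 has the entry
      -- just passed; otherwise the fact that an entry right above the dot would have come down and
      -- taken the dot away.
      dot-strip : ∀ k f → dot (suc k) f ≡ true → count (ρ k) f ≤ count (ρ (suc k)) f
      dot-strip k zero    d = ≤-trans (bit≤1 (ρ k 0)) (≤-reflexive (cong bit (sym (C⊆ (suc k) d))))
      dot-strip k (suc f) d with true-or-false (ρ (suc k) (suc f))
      ... | inj₁ r = ≤-trans (inter k f) (≤-reflexive (cong (λ b → bit b + count (ρ (suc k)) f) (sym r)))
      ... | inj₂ r with true-or-false (push k f)
      ...   | inj₁ p rewrite r | p | ∧-zeroʳ (dot (suc k) f) = case d of λ ()
      ...   | inj₂ p = ≤-trans bound (≤-reflexive (sym (count-false (suc k) f r)))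
        where
        bound : count (ρ k) (suc f) ≤ count (ρ (suc k)) f
        bound with true-or-false (ρ k (suc f))
        ... | inj₁ rk = push-tight k f rk p
        ... | inj₂ rk = ≤-trans (≤-reflexive (count-false k f rk)) (dot-strip k f (Removable.settled (dot-removable (suc k)) f r d))

      count-dotted : ∀ k f → dot k f ≡ true → count (ρ k) f ≡ suc (count (ρ′ k) f)
      count-dotted k f d = trans (dot-count k f) (cong (λ b → bit b + count (ρ′ k) f) d)

      count-undotted : ∀ k f → dot k f ≡ false → count (ρ k) f ≡ count (ρ′ k) f
      count-undotted k f d = trans (dot-count k f) (cong (λ b → bit b + count (ρ′ k) f) d)

      -- The bound is in danger only if row k + 2 loses an entry to a dot and row k + 1 does not;
      -- then `dot-strip`, or the failure of `push`, leaves one unit of slack.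
      interlaced′ : Interlaced ρ′
      interlaced′ k f with true-or-false (dot (suc k) f)
      ... | inj₂ d = begin
        count (ρ′ k) (suc f)        ≤⟨ m≤n+m _ (bit (dot k (suc f))) ⟩
        bit (dot k (suc f)) + count (ρ′ k) (suc f) ≡⟨ dot-count k (suc f) ⟨
        count (ρ k) (suc f)         ≤⟨ inter k f ⟩
        suc (count (ρ (suc k)) f)   ≡⟨ cong suc (count-undotted (suc k) f d) ⟩
        suc (count (ρ′ (suc k)) f) ∎
        where open ≤-Reasoning
      ... | inj₁ d with true-or-false (dot k (suc f))
      ...   | inj₁ d′ = ≤-pred (begin
        suc (count (ρ′ k) (suc f))  ≡⟨ count-dotted k (suc f) d′ ⟨
        count (ρ k) (suc f)         ≤⟨ inter k f ⟩
        suc (count (ρ (suc k)) f)   ≡⟨ cong suc (count-dotted (suc k) f d) ⟩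
        suc (suc (count (ρ′ (suc k)) f)) ∎)
        where open ≤-Reasoning
      ...   | inj₂ d′ = begin
        count (ρ′ k) (suc f)        ≡⟨ count-undotted k (suc f) d′ ⟨
        count (ρ k) (suc f)         ≤⟨ bound ⟩
        count (ρ (suc k)) f         ≡⟨ count-dotted (suc k) f d ⟩
        suc (count (ρ′ (suc k)) f) ∎
        where
        open ≤-Reasoning
        bound : count (ρ k) (suc f) ≤ count (ρ (suc k)) f
        bound with true-or-false (ρ k (suc f)) | true-or-false (push k f)
        ... | inj₂ r | _      = ≤-trans (≤-reflexive (count-false k f r)) (dot-strip k f d)
        ... | inj₁ r | inj₂ p = push-tight k f r p
        ... | inj₁ r | inj₁ p = case trans (sym d′) (dot-pushed k f d p) of λ ()

      -- Staying is cheaper in `ρ′` only where the row has lost an entry, and that requires a dot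
      -- climbing in from the row below.
      dot-born : ∀ k f → bit (ρ k (suc f)) ≤ bit (ρ′ k (suc f)) ⊎
        (dot (suc k) f ≡ true × push k f ≡ true × dot k f ≡ false × dot k (suc f) ≡ true)
      dot-born k f with true-or-false (ρ k (suc f)) | true-or-false (dot k f) | true-or-false (dot k (suc f))
      ... | inj₂ r | _      | _       = inj₁ (≤-trans (≤-reflexive (cong bit r)) z≤n)
      ... | inj₁ r | inj₁ d | _       rewrite r | d = inj₁ (s≤s z≤n)
      ... | inj₁ r | inj₂ d | inj₂ d′ = inj₁ (≤-reflexive (sym (ρ′≡ρ k f d d′)))
      ... | inj₁ r | inj₂ d | inj₁ d′ = inj₂ (let a , b = ∧-true (origin r d d′) in a , b , d , d′)
        where
        origin : ρ k (suc f) ≡ true → dot k f ≡ false → dot k (suc f) ≡ true → dot (suc k) f ∧ push k f ≡ true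
        origin r d d′ rewrite r | d = d′

      -- The alternatives mirror the recursion for longest chains: the first returns to `ρ`, with
      -- one more row if the last row receives a letter; the second keeps `ρ′` and skips the letter
      -- of the last row. A path of `ρ′` is followed, and the only obstacle is a value at which its
      -- row has lost an entry.
      cost′-lower : ∀ b s k f → C (s + k) ≡ b →
        cost ρ (bit b + s) k f ≤ cost ρ′ s k f ⊎ suc (cost ρ′ (suc s) k f) ≤ cost ρ′ s k f
      cost′-lower true  zero    k zero c = inj₁ z≤n
      cost′-lower false zero    k zero c rewrite c with ρ k 0
      ... | true  = inj₁ ≤-refl
      ... | false = inj₁ ≤-refl
      cost′-lower true  (suc s) k zero c = inj₁ z≤n
      cost′-lower false (suc s) k zero c = inj₁ z≤n
      cost′-lower b s k (suc f) c = combine s c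
        where
        open ≤-Reasoning
        Lower : ℕ → ℕ → ℕ → ℕ → Set
        Lower s k f x = cost ρ (bit b + s) k f ≤ x ⊎ suc (cost ρ′ (suc s) k f) ≤ x

        dropped : ∀ s → C (suc s + k) ≡ b → Lower (suc s) k (suc f) (cost ρ′ s (suc k) f)
        dropped s c with cost′-lower b s (suc k) f (trans (cong C (+-suc s k)) c)
        ... | inj₂ le = inj₂ (≤-trans (s≤s (cost-drop ρ′ (suc s) k f)) le)
        ... | inj₁ le = inj₁ (≤-trans (subst (λ z → cost ρ z k (suc f) ≤ cost ρ (bit b + s) (suc k) f) (sym (+-suc (bit b) s))
                                        (cost-drop ρ (bit b + s) k f)) le)

        stayed : ∀ s → Lower s k f (cost ρ′ s k f) → bit (ρ k (suc f)) ≤ bit (ρ′ k (suc f)) →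
          Lower s k (suc f) (bit (ρ′ k (suc f)) + cost ρ′ s k f)
        stayed s (inj₁ le) h = inj₁ (≤-trans (cost-stay ρ (bit b + s) k f) (+-mono-≤ h le))
        stayed s (inj₂ le) h = inj₂ (stay₂ s le)
          where
          stay₂ : ∀ s → suc (cost ρ′ (suc s) k f) ≤ cost ρ′ s k f → suc (cost ρ′ (suc s) k (suc f)) ≤ bit (ρ′ k (suc f)) + cost ρ′ s k f
          stay₂ s le = begin
            suc (cost ρ′ (suc s) k (suc f))                    ≤⟨ s≤s (cost-stay ρ′ (suc s) k f) ⟩
            suc (bit (ρ′ k (suc f)) + cost ρ′ (suc s) k f)     ≡⟨ +-suc (bit (ρ′ k (suc f))) _ ⟨
            bit (ρ′ k (suc f)) + suc (cost ρ′ (suc s) k f)     ≤⟨ +-monoʳ-≤ (bit (ρ′ k (suc f))) le ⟩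
            bit (ρ′ k (suc f)) + cost ρ′ s k f ∎

        tight′ : dot (suc k) f ≡ true → push k f ≡ true → dot k f ≡ false → dot k (suc f) ≡ true →
          count (ρ′ k) f ≡ suc (count (ρ′ (suc k)) f)
        tight′ d₂ p d d′ = trans (sym (count-undotted k f d)) (trans
          (suc-injective (trans (cong (λ z → bit z + count (ρ k) f) (sym (push-bit k f p))) (push-count k f p)))
          (count-dotted (suc k) f d₂))

        combine : ∀ s → C (s + k) ≡ b → Lower s k (suc f) (cost ρ′ s k (suc f))
        combine zero c with dot-born k f
        ... | inj₁ h = stayed 0 (cost′-lower b 0 k f c) h
        ... | inj₂ (d₂ , p , d , d′) = inj₂ (begin
          suc (cost ρ′ 1 k (suc f))             ≤⟨ s≤s (cost-drop ρ′ 0 k f) ⟩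
          suc (count (ρ′ (suc k)) f)            ≡⟨ tight′ d₂ p d d′ ⟨
          count (ρ′ k) f                        ≤⟨ m≤n+m _ (bit (ρ′ k (suc f))) ⟩
          count (ρ′ k) (suc f) ∎)
        combine (suc s) c with ⊓-sel (bit (ρ′ k (suc f)) + cost ρ′ (suc s) k f) (cost ρ′ s (suc k) f)
        ... | inj₂ eq = subst (Lower (suc s) k (suc f)) (sym eq) (dropped s c)
        ... | inj₁ eq with dot-born k f
        ...   | inj₁ h = subst (Lower (suc s) k (suc f)) (sym eq) (stayed (suc s) (cost′-lower b (suc s) k f c) h)
        -- A dot has climbed, so the two new rows are as close as possible, and by `cost-shift`
        -- changing rows is no worse than staying.
        ...   | inj₂ (d₂ , p , d , d′) = relax (dropped s c)
          where
          le : cost ρ′ s (suc k) f ≤ cost ρ′ (suc s) k (suc f)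
          le = begin
            cost ρ′ s (suc k) f                          ≤⟨ +-cancelʳ-≤ (count (ρ′ k) f) _ _ (≤-trans (cost-shift ρ′ interlaced′ s k f)
                                                             (≤-reflexive (cong (cost ρ′ (suc s) k f +_) (sym (tight′ d₂ p d d′))))) ⟩
            cost ρ′ (suc s) k f                          ≤⟨ m≤n+m _ (bit (ρ′ k (suc f))) ⟩
            bit (ρ′ k (suc f)) + cost ρ′ (suc s) k f     ≡⟨ eq ⟨
            cost ρ′ (suc s) k (suc f) ∎
          relax : Lower (suc s) k (suc f) (cost ρ′ s (suc k) f) → Lower (suc s) k (suc f) (cost ρ′ (suc s) k (suc f))
          relax (inj₁ x) = inj₁ (≤-trans x le)
          relax (inj₂ x) = inj₂ (≤-trans x le)

-- Longest monotone subsequences of a list.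

∈-sublists⁺ : ∀ {s xs : List ℕ} → s ⊆ xs → s ∈ sublists xs
∈-sublists⁺ [] = here refl
∈-sublists⁺ {xs = x ∷ xs} (.x ∷ʳ σ) = ∈-++⁺ʳ (map (x ∷_) (sublists xs)) (∈-sublists⁺ σ)
∈-sublists⁺ (refl ∷ σ) = ∈-++⁺ˡ (∈-map⁺ _ (∈-sublists⁺ σ))

∈-sublists⁻ : ∀ (xs : List ℕ) {s} → s ∈ sublists xs → s ⊆ xs
∈-sublists⁻ [] (here refl) = []
∈-sublists⁻ (x ∷ xs) s∈ with ∈-++⁻ (map (x ∷_) (sublists xs)) s∈
... | inj₂ s∈′ = x ∷ʳ ∈-sublists⁻ xs s∈′
... | inj₁ s∈′ with ∈-map⁻ (x ∷_) s∈′
...   | _ , t∈ , refl = refl ∷ ∈-sublists⁻ xs t∈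

longest : (List ℕ → Bool) → List ℕ → ℕ
longest p xs = foldr _⊔_ 0 (map (lenIf p) (sublists xs))

module _ (p : List ℕ → Bool) where

  longest-bound : ∀ {s xs} → s ⊆ xs → p s ≡ true → length s ≤ longest p xs
  longest-bound {s} {xs} σ ps = foldr-preservesᵒ
    (λ x y → Sum.[ (λ le → ≤-trans le (m≤m⊔n x y)) , (λ le → ≤-trans le (m≤n⊔m x y)) ])
    0 (map (lenIf p) (sublists xs))
    (inj₂ (lose (∈-map⁺ (lenIf p) (∈-sublists⁺ σ)) (≤-reflexive (cong (λ b → if b then length s else 0) (sym ps)))))

  longest-attained : p [] ≡ true → ∀ xs → ∃[ s ] s ⊆ xs × p s ≡ true × length s ≡ longest p xs
  longest-attained p[] xs = foldr-preservesᵇ pres empty (All.tabulate each)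
    where
    Attained : ℕ → Set
    Attained m = ∃[ s ] s ⊆ xs × p s ≡ true × length s ≡ m
    empty : Attained 0
    empty = [] , minimum xs , p[] , refl
    pres : ∀ {x y} → Attained x → Attained y → Attained (x ⊔ y)
    pres {x} {y} ax ay with ⊔-sel x y
    ... | inj₁ eq = subst Attained (sym eq) ax
    ... | inj₂ eq = subst Attained (sym eq) ay
    each : ∀ {m} → m ∈ map (lenIf p) (sublists xs) → Attained m
    each m∈ with ∈-map⁻ (lenIf p) m∈
    ... | s , s∈ , refl with p s in ps
    ...   | true  = s , ∈-sublists⁻ xs s∈ , ps , refl
    -- A sublist failing `p` contributes the default 0, which the empty list attains.
    ...   | false = empty

incr⁻ : ∀ s → strictlyIncr s ≡ true → AllPairs _<_ s
incr⁻ [] _ = []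
incr⁻ (x ∷ []) _ = [] ∷ []
incr⁻ (x ∷ y ∷ s) h = cons (<ᵇ-true⁻ (proj₁ h′)) (incr⁻ (y ∷ s) (proj₂ h′))
  where
  h′ = ∧-true {x <ᵇ y} h
  cons : x < y → AllPairs _<_ (y ∷ s) → AllPairs _<_ (x ∷ y ∷ s)
  cons x<y (y< ∷ r) = (x<y ∷ All.map (<-trans x<y) y<) ∷ y< ∷ r

incr⁺ : ∀ {s} → AllPairs _<_ s → strictlyIncr s ≡ true
incr⁺ [] = refl
incr⁺ (_ ∷ []) = refl
incr⁺ ((x<y ∷ _) ∷ r@(_ ∷ _)) = cong₂ _∧_ (<ᵇ-true⁺ x<y) (incr⁺ r)

decr⁻ : ∀ s → strictlyDecr s ≡ true → AllPairs _>_ s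
decr⁻ [] _ = []
decr⁻ (x ∷ []) _ = [] ∷ []
decr⁻ (x ∷ y ∷ s) h = cons (<ᵇ-true⁻ (proj₁ h′)) (decr⁻ (y ∷ s) (proj₂ h′))
  where
  h′ = ∧-true {y <ᵇ x} h
  cons : x > y → AllPairs _>_ (y ∷ s) → AllPairs _>_ (x ∷ y ∷ s)
  cons x>y (y> ∷ r) = (x>y ∷ All.map (flip <-trans x>y) y>) ∷ y> ∷ r

decr⁺ : ∀ {s} → AllPairs _>_ s → strictlyDecr s ≡ true
decr⁺ [] = refl
decr⁺ (_ ∷ []) = refl
decr⁺ ((x>y ∷ _) ∷ r@(_ ∷ _)) = cong₂ _∧_ (<ᵇ-true⁺ x>y) (decr⁺ r)

AllPairs-reverse : ∀ {R : ℕ → ℕ → Set} {s} → AllPairs R s → AllPairs (flip R) (reverse s)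
AllPairs-reverse [] = []
AllPairs-reverse {R} {x ∷ s} (rx ∷ r) = subst (AllPairs (flip R)) (sym (unfold-reverse x s))
  (AllPairsₚ.++⁺ (AllPairs-reverse r) ([] ∷ []) (All.tabulate (λ y∈ → All.lookup rx (Anyₚ.reverse⁻ y∈) ∷ [])))

lds-bound : ∀ {s xs} → s ⊆ xs → AllPairs _>_ s → length s ≤ lds xs
lds-bound σ r = longest-bound strictlyDecr σ (decr⁺ r)

lds-attained : ∀ xs → ∃[ s ] s ⊆ xs × AllPairs _>_ s × length s ≡ lds xs
lds-attained xs with longest-attained strictlyDecr refl xs
... | s , σ , d , eq = s , σ , decr⁻ s d , eq

-- Reversal exchanges increasing and decreasing sublists and keeps lengths; from here on `lds` is
-- enough.
lis≡lds-reverse : ∀ xs → lis xs ≡ lds (reverse xs)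
lis≡lds-reverse xs = ≤-antisym le ge
  where
  le : lis xs ≤ lds (reverse xs)
  le with longest-attained strictlyIncr refl xs
  ... | s , σ , d , eq = subst (_≤ lds (reverse xs)) (trans (length-reverse s) eq)
    (lds-bound (reverse⁺ σ) (AllPairs-reverse (incr⁻ s d)))
  ge : lds (reverse xs) ≤ lis xs
  ge with lds-attained (reverse xs)
  ... | s , σ , d , eq = subst₂ _≤_ (trans (length-reverse s) eq) (cong lis (reverse-involutive xs))
    (longest-bound strictlyIncr (reverse⁺ σ) (incr⁺ (AllPairs-reverse d)))

-- Absorbing the letters value by value.

slice : (ℕ → ℕ) → ℕ → ℕ → List ℕ
slice ℓ lo zero    = []
slice ℓ lo (suc d) = ℓ lo ∷ slice ℓ (suc lo) d

module Evolution (n : ℕ) (ℓ : ℕ → ℕ) where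

  moving : ℕ → Bits
  moving v k = (k <ᵇ n) ∧ (ℓ k ≡ᵇ suc v)

  -- Initially row k + 1 of the staircase holds the values k + 1, ..., n - 1, and the mark n stands
  -- for its antidiagonal box. Each later stage slides the dots placed at the letters equal to
  -- `suc v`.
  state : ℕ → ℕ → Bits
  state zero    k f = k + f <ᵇ n
  state (suc v)     = Slide.ρ′ (state v) (moving v)

  count-initial : ∀ k f → k + f < n → count (state 0 k) f ≡ suc f
  count-initial k zero    k<n = cong bit (<ᵇ-true⁺ k<n)
  count-initial k (suc f) k<n = cong₂ _+_ (cong bit (<ᵇ-true⁺ k<n))
    (count-initial k f (≤-<-trans (+-monoʳ-≤ k (n≤1+n f)) k<n))

  count-shift : ∀ k f → count (state 0 k) (suc f) ≡ bit (state 0 k 0) + count (state 0 (suc k)) f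
  count-shift k zero    rewrite +-suc k 0 = +-comm (bit (suc k + 0 <ᵇ n)) _
  count-shift k (suc f) rewrite count-shift k f | +-suc k (suc f) =
    x∙yz≈y∙xz +-commutativeSemigroup (bit (suc k + suc f <ᵇ n)) (bit (state 0 k 0)) _

  interlaced-initial : Interlaced (state 0)
  interlaced-initial k f = ≤-trans (≤-reflexive (count-shift k f)) (+-monoˡ-≤ _ (bit≤1 _))

  -- In the initial tableau every passage within a row costs one unit, so a path saves only by its
  -- at most `s` changes of row.
  cost-initial : ∀ s k f → k + f < n → suc f ≤ cost (state 0) s k f + s
  cost-initial zero    k f       h = ≤-reflexive (sym (trans (+-identityʳ _) (count-initial k f h)))
  cost-initial (suc s) k zero    h = s≤s z≤n
  cost-initial (suc s) k (suc f) h with ⊓-sel (bit (state 0 k (suc f)) + cost (state 0) (suc s) k f) (cost (state 0) s (suc k) f)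
  ... | inj₁ eq rewrite eq | <ᵇ-true⁺ h = s≤s (cost-initial (suc s) k f (≤-<-trans (+-monoʳ-≤ k (n≤1+n f)) h))
  ... | inj₂ eq rewrite eq | +-suc (cost (state 0) s (suc k) f) s =
    s≤s (cost-initial s (suc k) f (≤-trans (≤-reflexive (cong suc (sym (+-suc k f)))) h))

  module _ (positive : ∀ k → k < n → 0 < ℓ k) where

    <∧≢ : ∀ v x → (v <ᵇ x) ∧ not (x ≡ᵇ suc v) ≡ (suc v <ᵇ x)
    <∧≢ v       zero          = refl
    <∧≢ zero    (suc zero)    = refl
    <∧≢ zero    (suc (suc x)) = refl
    <∧≢ (suc v) (suc x)       = <∧≢ v x

    state-unfilled : ∀ v k → state v k 0 ≡ (k <ᵇ n) ∧ (v <ᵇ ℓ k)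
    state-unfilled zero k rewrite +-identityʳ k with k <ᵇ n in lt
    ... | false = refl
    ... | true  = sym (<ᵇ-true⁺ (positive k (<ᵇ-true⁻ lt)))
    state-unfilled (suc v) k rewrite state-unfilled v k with k <ᵇ n
    ... | false = refl
    ... | true  = <∧≢ v (ℓ k)

    moving⇒unfilled : ∀ v k → moving v k ≡ true → state v k 0 ≡ true
    moving⇒unfilled v k m with ∧-true {k <ᵇ n} m
    ... | k<n , eq = trans (state-unfilled v k) (cong₂ _∧_ k<n (<ᵇ-true⁺ (≤-reflexive (sym (≡ᵇ-sound {ℓ k} {suc v} eq)))))

    interlaced : ∀ v → Interlaced (state v)
    interlaced zero    = interlaced-initial
    interlaced (suc v) = Slide.interlaced′ (state v) (moving v) (moving⇒unfilled v) (interlaced v)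

    cost-antitone : ∀ d v s f → cost (state (d + v)) s 0 f ≤ cost (state v) s 0 f
    cost-antitone zero    v s f = ≤-refl
    cost-antitone (suc d) v s f = ≤-trans
      (Slide.cost′-upper (state (d + v)) (moving (d + v)) (moving⇒unfilled (d + v)) (interlaced (d + v)) s f)
      (cost-antitone d v s f)

    module _ (f : ℕ) (f<n : f < n) where

      -- Skipping a letter loses at most one, by `cost-suc`. Taking a letter `suc u` goes back to
      -- the stage before it was absorbed: `cost′-upper-C` supplies the extra row, and the remaining
      -- letters are at most `u`.
      decreasing-cost : ∀ {s} b lo d → lo + d ≡ suc f → s ⊆ slice ℓ lo d → AllPairs _>_ s → All (_≤ b) s →
        length s + cost (state b) lo 0 f ≤ d
      decreasing-cost b lo zero lo≡ [] [] []
        rewrite trans (sym (+-identityʳ lo)) lo≡ = ≤-reflexive (cost-diagonal (state b) 0 f)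
      decreasing-cost {s} b lo (suc d) lo≡ (_ ∷ʳ σ) dec s≤b = begin
        length s + cost (state b) lo 0 f             ≤⟨ +-monoʳ-≤ (length s) (cost-suc (state b) (interlaced b) lo 0 f) ⟩
        length s + suc (cost (state b) (suc lo) 0 f) ≡⟨ +-suc (length s) _ ⟩
        suc (length s + cost (state b) (suc lo) 0 f) ≤⟨ s≤s (decreasing-cost b (suc lo) d (trans (sym (+-suc lo d)) lo≡) σ dec s≤b) ⟩
        suc d ∎
        where open ≤-Reasoning
      decreasing-cost {_ ∷ s} b lo (suc d) lo≡ (refl ∷ σ) (x> ∷ dec) (x≤b ∷ _) with ℓ lo in ℓlo
      ... | zero  = case subst (0 <_) ℓlo (positive lo lo<n) of λ ()
        where
        lo<n : lo < n
        lo<n = ≤-<-trans (≤-pred (≤-trans (m<m+n lo (s≤s z≤n)) (≤-reflexive lo≡))) f<n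
      ... | suc u = s≤s (begin
        length s + cost (state b) lo 0 f        ≤⟨ +-monoʳ-≤ (length s) later ⟩
        length s + cost (state (suc u)) lo 0 f  ≤⟨ +-monoʳ-≤ (length s) (Slide.cost′-upper-C (state u) (moving u)
                                                     (moving⇒unfilled u) (interlaced u) lo f moved) ⟩
        length s + cost (state u) (suc lo) 0 f  ≤⟨ decreasing-cost u (suc lo) d (trans (sym (+-suc lo d)) lo≡) σ dec (All.map ≤-pred x>) ⟩
        d ∎)
        where
        open ≤-Reasoning
        later : cost (state b) lo 0 f ≤ cost (state (suc u)) lo 0 f
        later = subst (λ z → cost (state z) lo 0 f ≤ cost (state (suc u)) lo 0 f) (m∸n+n≡m x≤b) (cost-antitone (b ∸ suc u) (suc u) lo f)
        lo<n : lo < n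
        lo<n = ≤-<-trans (≤-pred (≤-trans (m<m+n lo (s≤s z≤n)) (≤-reflexive lo≡))) f<n
        moved : moving u lo ≡ true
        moved = cong₂ _∧_ (<ᵇ-true⁺ lo<n) (trans (cong (_≡ᵇ suc u) ℓlo) (≡ᵇ-true {u} refl))

      -- The alternatives of `cost′-lower` tell how to build the subsequence: each either lowers
      -- `b`, taking the letter if it equals `suc b`, or skips a letter of the slice.
      cost-decreasing : ∀ b lo d → lo + d ≡ suc f →
        ∃[ s ] s ⊆ slice ℓ lo d × AllPairs _>_ s × All (_≤ b) s × d ≤ length s + cost (state b) lo 0 f
      -- The empty sequence suffices, as the cost in the initial tableau is already at least `d`.
      cost-decreasing zero lo d lo≡ = [] , minimum _ , [] , [] , +-cancelʳ-≤ lo _ _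
        (≤-trans (≤-reflexive (trans (+-comm d lo) lo≡)) (cost-initial lo 0 f f<n))
      cost-decreasing (suc b) lo zero lo≡ = [] , [] , [] , [] , z≤n
      cost-decreasing (suc b) lo (suc d) lo≡
        with true-or-false (moving b lo)
      ... | inj₁ m = grow (Slide.cost′-lower (state b) (moving b) (moving⇒unfilled b) (interlaced b) true lo 0 f
                             (trans (cong (moving b) (+-identityʳ lo)) m))
        where
        lo≡′ : suc lo + d ≡ suc f
        lo≡′ = trans (sym (+-suc lo d)) lo≡
        grow : cost (state b) (suc lo) 0 f ≤ cost (state (suc b)) lo 0 f ⊎
               suc (cost (state (suc b)) (suc lo) 0 f) ≤ cost (state (suc b)) lo 0 f → _
        grow (inj₁ le) with cost-decreasing b (suc lo) d lo≡′
        ... | s , σ , dec , s≤b , h = ℓ lo ∷ s , refl ∷ σ ,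
              All.map (λ x≤b → ≤-trans (s≤s x≤b) (≤-reflexive (sym ℓlo))) s≤b ∷ dec ,
              ≤-reflexive ℓlo ∷ All.map m≤n⇒m≤1+n s≤b , s≤s (≤-trans h (+-monoʳ-≤ (length s) le))
          where
          ℓlo : ℓ lo ≡ suc b
          ℓlo = ≡ᵇ-sound {ℓ lo} {suc b} (proj₂ (∧-true {lo <ᵇ n} m))
        grow (inj₂ le) with cost-decreasing (suc b) (suc lo) d lo≡′
        ... | s , σ , dec , s≤b , h = s , _ ∷ʳ σ , dec , s≤b ,
              ≤-trans (s≤s h) (≤-trans (≤-reflexive (sym (+-suc (length s) _))) (+-monoʳ-≤ (length s) le))
      ... | inj₂ m = keep (Slide.cost′-lower (state b) (moving b) (moving⇒unfilled b) (interlaced b) false lo 0 f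
                             (trans (cong (moving b) (+-identityʳ lo)) m))
        where
        keep : cost (state b) lo 0 f ≤ cost (state (suc b)) lo 0 f ⊎
               suc (cost (state (suc b)) (suc lo) 0 f) ≤ cost (state (suc b)) lo 0 f → _
        keep (inj₁ le) with cost-decreasing b lo (suc d) lo≡
        ... | s , σ , dec , s≤b , h = s , σ , dec , All.map m≤n⇒m≤1+n s≤b , ≤-trans h (+-monoʳ-≤ (length s) le)
        keep (inj₂ le) with cost-decreasing (suc b) (suc lo) d (trans (sym (+-suc lo d)) lo≡)
        ... | s , σ , dec , s≤b , h = s , _ ∷ʳ σ , dec , s≤b ,
              ≤-trans (s≤s h) (≤-trans (≤-reflexive (sym (+-suc (length s) _))) (+-monoʳ-≤ (length s) le))

      -- The slice belongs to rows lo + 1, ..., f + 1, while the path starts in row 1 with value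
      -- `n ∸ f` and may use rows 1, ..., lo + 1. Both bounds on the chain length meet.
      lds-cost : ∀ b lo d → lo + d ≡ suc f → All (_≤ b) (slice ℓ lo d) →
        lds (slice ℓ lo d) + cost (state b) lo 0 f ≡ d
      lds-cost b lo d lo≡ ≤b = ≤-antisym upper lower
        where
        upper : lds (slice ℓ lo d) + cost (state b) lo 0 f ≤ d
        upper with lds-attained (slice ℓ lo d)
        ... | s , σ , dec , eq = subst (λ z → z + cost (state b) lo 0 f ≤ d) eq
              (decreasing-cost b lo d lo≡ σ dec (All-resp-⊆ σ ≤b))
        lower : d ≤ lds (slice ℓ lo d) + cost (state b) lo 0 f
        lower with cost-decreasing b lo d lo≡
        ... | s , σ , dec , _ , h = ≤-trans h (+-monoˡ-≤ _ (lds-bound σ dec))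

-- Monotone counts, and reverse jeu de taquin as a local rule on cells.

count-mono : ∀ τ {f g} → f ≤ g → count τ f ≤ count τ g
count-mono τ {f} {g} f≤g = subst (λ z → count τ f ≤ count τ z) (m∸n+n≡m f≤g) (go (g ∸ f))
  where
  go : ∀ d → count τ f ≤ count τ (d + f)
  go zero    = ≤-refl
  go (suc d) = ≤-trans (go d) (m≤n+m _ _)

count-hit : ∀ τ {f} → τ (suc f) ≡ true → count τ (suc f) ≡ suc (count τ f)
count-hit τ {f} t = cong (λ b → bit b + count τ f) t

count-miss : ∀ τ {f} → τ (suc f) ≡ false → count τ (suc f) ≡ count τ f
count-miss τ {f} t = cong (λ b → bit b + count τ f) t

_≗₂_ : Filling → Filling → Set
F ≗₂ G = ∀ r c → F r c ≡ G r c

-- The new content depends only on the cell and its four neighbours, which makes congruence and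
-- symmetry under transposition visible.
stepCell : ℕ → (x up lf dn rt : Cell) → Cell
stepCell i ∅       up lf dn rt = ∅
stepCell i •       up lf dn rt = if isNum i up ∨ isNum i lf then num i else •
stepCell i (num x) up lf dn rt = if (x ≡ᵇ i) ∧ (isDot dn ∨ isDot rt) then • else num x

rjdtStep-local : ∀ i F r c → rjdtStep i F r c ≡ stepCell i (F r c) (above F r c) (left F r c) (below F r c) (right F r c)
rjdtStep-local i F r c with F r c
... | ∅     = refl
... | •     = refl
... | num x = refl

above-cong : ∀ {F G} → F ≗₂ G → ∀ r c → above F r c ≡ above G r c
above-cong e zero    c = refl
above-cong e (suc r) c = e r c

left-cong : ∀ {F G} → F ≗₂ G → ∀ r c → left F r c ≡ left G r c
left-cong e r zero    = refl
left-cong e r (suc c) = e r c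

stepCell-cong : ∀ i {x x′ u u′ l l′ d d′ r r′} → x ≡ x′ → u ≡ u′ → l ≡ l′ → d ≡ d′ → r ≡ r′ →
  stepCell i x u l d r ≡ stepCell i x′ u′ l′ d′ r′
stepCell-cong i refl refl refl refl refl = refl

rjdtStep-cong : ∀ i {F G} → F ≗₂ G → rjdtStep i F ≗₂ rjdtStep i G
rjdtStep-cong i {F} {G} e r c = trans (rjdtStep-local i F r c) (trans
  (stepCell-cong i (e r c) (above-cong e r c) (left-cong e r c) (e (suc r) c) (e r (suc c)))
  (sym (rjdtStep-local i G r c)))

rjdtSteps-cong : ∀ a {F G} → F ≗₂ G → rjdtSteps a F ≗₂ rjdtSteps a G
rjdtSteps-cong zero    e = e
rjdtSteps-cong (suc a) e = rjdtSteps-cong a (rjdtStep-cong (suc a) e)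

_ᵗ : Filling → Filling
(F ᵗ) r c = F c r

rjdtStep-transpose : ∀ i F → rjdtStep i (F ᵗ) ≗₂ (rjdtStep i F ᵗ)
rjdtStep-transpose i F r c = trans (rjdtStep-local i (F ᵗ) r c) (trans
  (trans (stepCell-cong i {F c r} {d = F c (suc r)} {r = F (suc c) r} refl (above-t r) (left-t c) refl refl) (swap (F c r)))
  (sym (rjdtStep-local i F c r)))
  where
  above-t : ∀ r → above (F ᵗ) r c ≡ left F c r
  above-t zero    = refl
  above-t (suc r) = refl
  left-t : ∀ c → left (F ᵗ) r c ≡ above F c r
  left-t zero    = refl
  left-t (suc c) = refl
  swap : ∀ x {u l d r} → stepCell i x u l d r ≡ stepCell i x l u r d
  swap ∅ = refl
  swap • {u} {l} = cong (if_then num i else •) (∨-comm (isNum i u) (isNum i l))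
  swap (num x) {_} {_} {d} {r} = cong (λ b → if (x ≡ᵇ i) ∧ b then • else num x) (∨-comm (isDot d) (isDot r))

rjdtSteps-transpose : ∀ a {F G} → G ≗₂ (F ᵗ) → rjdtSteps a G ≗₂ (rjdtSteps a F ᵗ)
rjdtSteps-transpose zero    e = e
rjdtSteps-transpose (suc a) {F} e = rjdtSteps-transpose a λ r c →
  trans (rjdtStep-cong (suc a) e r c) (rjdtStep-transpose (suc a) F r c)

clean : Cell → Cell
clean • = ∅
clean x = x

deleteDots-local : ∀ F r c → deleteDots F r c ≡ clean (F r c)
deleteDots-local F r c with F r c
... | ∅     = refl
... | •     = refl
... | num x = refl

Below : ℕ → Filling → Set
Below a F = ∀ r c x → F r c ≡ num x → x ≤ a

rjdtStep-idle : ∀ {a i F} → Below a F → a < i → rjdtStep i F ≗₂ F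
rjdtStep-idle {a} {i} {F} below a<i r c = trans (rjdtStep-local i F r c)
  (idle (F r c) (below r c) (no-num-above r) (no-num-left c))
  where
  no-num : ∀ y → (∀ x → y ≡ num x → x ≤ a) → isNum i y ≡ false
  no-num ∅       h = refl
  no-num •       h = refl
  no-num (num x) h = ≡ᵇ-false (<⇒≢ (≤-<-trans (h x refl) a<i))
  no-num-above : ∀ r → isNum i (above F r c) ≡ false
  no-num-above zero    = refl
  no-num-above (suc r) = no-num _ (below r c)
  no-num-left : ∀ c → isNum i (left F r c) ≡ false
  no-num-left zero    = refl
  no-num-left (suc c) = no-num _ (below r c)
  idle : ∀ y {u l d r} → (∀ x → y ≡ num x → x ≤ a) → isNum i u ≡ false → isNum i l ≡ false → stepCell i y u l d r ≡ y
  idle ∅       h nu nl = refl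
  idle •       h nu nl rewrite nu | nl = refl
  idle (num x) h nu nl rewrite no-num (num x) h = refl

rjdtSteps-idle : ∀ d {a F} → Below a F → rjdtSteps (d + a) F ≗₂ rjdtSteps a F
rjdtSteps-idle zero    below r c = refl
rjdtSteps-idle (suc d) {a} below r c = trans
  (rjdtSteps-cong (d + a) (rjdtStep-idle below (s≤s (m≤n+m a d))) r c)
  (rjdtSteps-idle d below r c)

-- Steps for values above every entry are idle. Hence starting at the largest entry, as the
-- definition does, agrees with starting at `m`, as the analysis of rows does.
rjdtSteps-bound : ∀ {a b F} → Below a F → Below b F → rjdtSteps a F ≗₂ rjdtSteps b F
rjdtSteps-bound {a} {b} {F} ba bb r c with ≤-total a b
... | inj₁ a≤b = sym (subst (λ z → rjdtSteps z F r c ≡ rjdtSteps a F r c) (m∸n+n≡m a≤b) (rjdtSteps-idle (b ∸ a) ba r c))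
... | inj₂ b≤a = subst (λ z → rjdtSteps z F r c ≡ rjdtSteps b F r c) (m∸n+n≡m b≤a) (rjdtSteps-idle (a ∸ b) bb r c)

-- Fillings of the staircase

module Staircase (m : ℕ) where

  n : ℕ
  n = suc m

  -- Rows are pushed against the antidiagonal, so the distance of an entry from it is the number of
  -- larger entries of its row, the mark n included. The mark itself shows as an empty cell, and bit
  -- `suc f` belongs to the entry `m ∸ f`.
  look : Bits → ℕ → ℕ → Cell
  look τ zero    δ = ∅
  look τ (suc f) δ = if τ (suc f) ∧ (δ ≡ᵇ count τ f) then num (m ∸ f) else look τ f δ

  look-num : ∀ τ g {δ x} → look τ g δ ≡ num x → ∃[ h ] h < g × τ (suc h) ≡ true × δ ≡ count τ h × x ≡ m ∸ h
  look-num τ (suc f) {δ} eq with τ (suc f) ∧ (δ ≡ᵇ count τ f) in t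
  look-num τ (suc f) refl | true = f , ≤-refl , proj₁ (∧-true t) , ≡ᵇ-sound (proj₂ (∧-true {τ (suc f)} t)) , refl
  ... | false with look-num τ f eq
  ...   | h , h<f , rest = h , m≤n⇒m≤1+n h<f , rest

  look-not-• : ∀ τ g {δ} → look τ g δ ≢ •
  look-not-• τ (suc f) {δ} eq with τ (suc f) ∧ (δ ≡ᵇ count τ f)
  ... | false = look-not-• τ f eq

  look-stable : ∀ τ {f g δ} → f ≤ g → δ < count τ f → look τ g δ ≡ look τ f δ
  look-stable τ {f} {g} {δ} f≤g δ< = subst (λ z → look τ z δ ≡ look τ f δ) (m∸n+n≡m f≤g) (go (g ∸ f))
    where
    go : ∀ d → look τ (d + f) δ ≡ look τ f δ
    go zero = refl
    go (suc d) rewrite ≡ᵇ-false {δ} {count τ (d + f)} (<⇒≢ (<-≤-trans δ< (count-mono τ (m≤n+m f d))))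
      | ∧-zeroʳ (τ (suc (d + f))) = go d

  look-hit : ∀ τ {h g δ} → h < g → τ (suc h) ≡ true → δ ≡ count τ h → look τ g δ ≡ num (m ∸ h)
  look-hit τ {h} {g} {δ} h<g t refl = trans
    (look-stable τ h<g (≤-reflexive (sym (count-hit τ t))))
    (cong (λ b → if b then num (m ∸ h) else look τ h δ) (cong₂ _∧_ t (≡ᵇ-true {count τ h} refl)))

  look-empty : ∀ τ {g δ} → count τ g ≤ δ → look τ g δ ≡ ∅
  look-empty τ {g} {δ} le with look τ g δ in eq
  ... | ∅     = refl
  ... | •     = contradiction eq (look-not-• τ g)
  ... | num x with look-num τ g eq
  ...   | h , h<g , t , refl , _ = contradiction (≤-trans (count-mono τ h<g) le) (<⇒≱ (≤-reflexive (sym (count-hit τ t))))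

  isNum-look : ∀ τ {f δ} → f < m → isNum (m ∸ f) (look τ m δ) ≡ τ (suc f) ∧ (δ ≡ᵇ count τ f)
  isNum-look τ {f} {δ} f<m = true-⇔ to from
    where
    to : isNum (m ∸ f) (look τ m δ) ≡ true → τ (suc f) ∧ (δ ≡ᵇ count τ f) ≡ true
    to e with look τ m δ in eq
    ... | num x with look-num τ m eq
    ...   | h , h<m , t , refl , refl with ∸-cancelˡ-≡ (<⇒≤ h<m) (<⇒≤ f<m) (≡ᵇ-sound e)
    ...     | refl = cong₂ _∧_ t (≡ᵇ-true {count τ h} refl)
    from : τ (suc f) ∧ (δ ≡ᵇ count τ f) ≡ true → isNum (m ∸ f) (look τ m δ) ≡ true
    from e rewrite look-hit τ {f} {m} {δ} f<m (proj₁ (∧-true e)) (≡ᵇ-sound (proj₂ (∧-true {τ (suc f)} e))) = ≡ᵇ-true {m ∸ f} refl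

  -- The box in row k + 1 and column c lies δ steps from the antidiagonal when k + δ + c = n.
  record Shape (cell : ℕ → ℕ → Cell) (F : Filling) : Set where
    field
      top     : ∀ c → F 0 c ≡ ∅
      box     : ∀ k δ c → k + δ + c ≡ n → F (suc k) c ≡ cell k δ
      outside : ∀ k c → n < k + c → F (suc k) c ≡ ∅
  open Shape public

  Represents : (ℕ → Bits) → Filling → Set
  Represents ρ = Shape (λ k → look (ρ k) m)

  -- Row k + 1 has `n ∸ k` boxes up to the antidiagonal; the bound keeps entries out of column 0.
  Bounded : (ℕ → Bits) → Set
  Bounded ρ = ∀ k f → count (ρ k) f ≤ n ∸ k

  Shape-cell : ∀ {cell F} → Shape cell F → ∀ r c → F r c ≡ ∅ ⊎
    ∃[ k ] ∃[ δ ] r ≡ suc k × k + δ + c ≡ n × F r c ≡ cell k δ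
  Shape-cell s zero    c = inj₁ (top s c)
  Shape-cell s (suc k) c with ≤-total (k + c) n
  ... | inj₁ le = inj₂ (k , n ∸ (k + c) , refl , sum , box s k _ c sum)
    where
    sum : k + (n ∸ (k + c)) + c ≡ n
    sum = trans (xy∙z≈xz∙y +-commutativeSemigroup k (n ∸ (k + c)) c) (m+[n∸m]≡n le)
  ... | inj₂ ge with m≤n⇒m<n∨m≡n ge
  ...   | inj₁ gt = inj₁ (outside s k c gt)
  ...   | inj₂ eq = inj₂ (k , 0 , refl , sum , box s k 0 c sum)
    where
    sum : k + 0 + c ≡ n
    sum = trans (cong (_+ c) (+-identityʳ k)) (sym eq)

  Shape-cong : ∀ {cell F G} → F ≗₂ G → Shape cell F → Shape cell G
  Shape-cong e s = record
    { top     = λ c → trans (sym (e 0 c)) (top s c)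
    ; box     = λ k δ c sum → trans (sym (e (suc k) c)) (box s k δ c sum)
    ; outside = λ k c h → trans (sym (e (suc k) c)) (outside s k c h)
    }

  record Marks (C : Bits) (B : ℕ → ℕ → Bool) : Set where
    field
      top-mark     : ∀ c → B 0 c ≡ false
      box-mark     : ∀ k δ c → k + δ + c ≡ n → B (suc k) c ≡ C k ∧ (δ ≡ᵇ 0)
      outside-mark : ∀ k c → n < k + c → B (suc k) c ≡ false
  open Marks public

  overlay-Below : ∀ {a B F} → Below a F → Below a (overlay B F)
  overlay-Below {a} {B} below r c x eq with B r c
  ... | false = below r c x eq

  -- The fillings in the course of one reverse slide.

  module Stages (ρ : ℕ → Bits) (C : Bits) (C⊆ : ∀ k → C k ≡ true → ρ k 0 ≡ true)
                (inter : Interlaced ρ) (bounded : Bounded ρ) where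
    open Slide ρ C

    -- The filling after `f` steps. Read from the antidiagonal to the left, a row consists of the
    -- values already treated, in their new places, then its dot if there is one, then the values
    -- not yet treated.
    stage : ℕ → ℕ → ℕ → Cell
    stage f k δ =
      if δ <ᵇ count (ρ′ k) f then look (ρ′ k) f δ
      else if dot k f ∧ (δ ≡ᵇ count (ρ′ k) f) then • else look (ρ k) m δ

    stage-new : ∀ {f k δ} → δ < count (ρ′ k) f → stage f k δ ≡ look (ρ′ k) f δ
    stage-new lt rewrite <ᵇ-true⁺ lt = refl

    stage-dot : ∀ {f k δ} → dot k f ≡ true → δ ≡ count (ρ′ k) f → stage f k δ ≡ •
    stage-dot {f} {k} d refl
      rewrite <ᵇ-false {count (ρ′ k) f} ≤-refl | d | ≡ᵇ-true {count (ρ′ k) f} refl = refl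

    count′≤count : ∀ k f → count (ρ′ k) f ≤ count (ρ k) f
    count′≤count k f = ≤-trans (m≤n+m _ (bit (dot k f))) (≤-reflexive (sym (dot-count C⊆ k f)))

    stage-old : ∀ {f k δ} → count (ρ k) f ≤ δ → stage f k δ ≡ look (ρ k) m δ
    stage-old {f} {k} {δ} le rewrite <ᵇ-false (≤-trans (count′≤count k f) le) with true-or-false (dot k f)
    ... | inj₂ d rewrite d = refl
    ... | inj₁ d rewrite ≡ᵇ-false {δ} {count (ρ′ k) f} (>⇒≢ (≤-trans (≤-reflexive (sym (count-dotted C⊆ inter k f d))) le))
                       | ∧-zeroʳ (dot k f) = refl

    data View (f k δ : ℕ) : Set where
      new : δ < count (ρ′ k) f → View f k δ
      dotted : dot k f ≡ true → δ ≡ count (ρ′ k) f → View f k δ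
      old : count (ρ k) f ≤ δ → View f k δ

    view : ∀ f k δ → View f k δ
    view f k δ with δ <? count (ρ′ k) f
    ... | yes lt = new lt
    ... | no ¬lt with true-or-false (dot k f)
    ...   | inj₂ d = old (≤-trans (≤-reflexive (count-undotted C⊆ inter k f d)) (≮⇒≥ ¬lt))
    ...   | inj₁ d with m≤n⇒m<n∨m≡n (≮⇒≥ ¬lt)
    ...     | inj₁ lt = old (≤-trans (≤-reflexive (count-dotted C⊆ inter k f d)) lt)
    ...     | inj₂ eq = dotted d (sym eq)

    -- The values already treated exceed `m ∸ f`, so this value stands only where `ρ` puts it.
    isNum-stage : ∀ {f} k δ → f < m → isNum (m ∸ f) (stage f k δ) ≡ ρ k (suc f) ∧ (δ ≡ᵇ count (ρ k) f)
    isNum-stage {f} k δ f<m with view f k δ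
    ... | old le rewrite stage-old {f} {k} le = isNum-look (ρ k) f<m
    ... | dotted d refl rewrite stage-dot {f} {k} d refl
      | ≡ᵇ-false {count (ρ′ k) f} {count (ρ k) f} (<⇒≢ (≤-reflexive (sym (count-dotted C⊆ inter k f d)))) = sym (∧-zeroʳ (ρ k (suc f)))
    ... | new lt rewrite stage-new {f} {k} lt
      | ≡ᵇ-false {δ} {count (ρ k) f} (<⇒≢ (<-≤-trans lt (count′≤count k f))) = trans miss (sym (∧-zeroʳ (ρ k (suc f))))
      where
      miss : isNum (m ∸ f) (look (ρ′ k) f δ) ≡ false
      miss with look (ρ′ k) f δ in eq
      ... | ∅     = refl
      ... | •     = refl
      ... | num x with look-num (ρ′ k) f eq
      ...   | h , h<f , _ , _ , refl = ≡ᵇ-false λ e → <⇒≢ h<f (∸-cancelˡ-≡ (<⇒≤ (<-trans h<f f<m)) (<⇒≤ f<m) e)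

    isDot-look : ∀ τ g δ → isDot (look τ g δ) ≡ false
    isDot-look τ g δ with look τ g δ in eq
    ... | ∅     = refl
    ... | •     = contradiction eq (look-not-• τ g)
    ... | num x = refl

    isDot-stage : ∀ f k δ → isDot (stage f k δ) ≡ dot k f ∧ (δ ≡ᵇ count (ρ′ k) f)
    isDot-stage f k δ with view f k δ
    ... | dotted d refl rewrite stage-dot {f} {k} d refl | d = sym (≡ᵇ-true {count (ρ′ k) f} refl)
    ... | new lt rewrite stage-new {f} {k} lt | ≡ᵇ-false {δ} {count (ρ′ k) f} (<⇒≢ lt) | ∧-zeroʳ (dot k f) = isDot-look (ρ′ k) f δ
    ... | old le rewrite stage-old {f} {k} le with true-or-false (dot k f)
    ...   | inj₂ d rewrite d = isDot-look (ρ k) m δ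
    ...   | inj₁ d rewrite ≡ᵇ-false {δ} {count (ρ′ k) f} (>⇒≢ (≤-trans (≤-reflexive (sym (count-dotted C⊆ inter k f d))) le))
                         | ∧-zeroʳ (dot k f) = isDot-look (ρ k) m δ

    remove-hit : ∀ k f → ρ k (suc f) ≡ true → dot k f ≡ true ⊎ dot k (suc f) ≡ false → ρ′ k (suc f) ≡ true
    remove-hit k f r h = trans (if-true r) (go h)
      where
      go : dot k f ≡ true ⊎ dot k (suc f) ≡ false → dot k f ∨ not (dot k (suc f)) ≡ true
      go (inj₁ d)  = cong (_∨ not (dot k (suc f))) d
      go (inj₂ d′) = trans (cong (λ b → dot k f ∨ not b) d′) (∨-zeroʳ _)

    remove-blocked : ∀ k f → ρ k (suc f) ≡ false → dot k f ≡ true → blocked k f ≡ true → ρ′ k (suc f) ≡ true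
    remove-blocked k f r d b = trans (if-false r) (cong₂ (λ x y → x ∧ not y) d
      (trans (if-false r) (trans (cong (λ y → dot k f ∧ not y) b) (∧-zeroʳ (dot k f)))))

    dot-hit : ∀ k f → ρ k (suc f) ≡ true → dot k (suc f) ≡ dot k f ∨ (dot (suc k) f ∧ push k f)
    dot-hit k f r = if-true r

    keep : ∀ i x {u l d r} → isNum i x ≡ false → x ≢ • → stepCell i x u l d r ≡ x
    keep i ∅       _ _  = refl
    keep i •       _ x≢ = contradiction refl x≢
    keep i (num x) h _  rewrite h = refl

    -- The equation tested by `push` is geometric: the entry lies right above a dot if its distance
    -- from the antidiagonal is one more than that of the dot.
    blocked-above : ∀ k f {δ} → suc δ ≡ count (ρ (suc k)) f →
      ρ k (suc f) ∧ (suc δ ≡ᵇ count (ρ k) f) ≡ push k f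
    blocked-above k f {δ} eq = trans (true-⇔ to from) (sym (push-def k f))
      where
      to : ρ k (suc f) ∧ (suc δ ≡ᵇ count (ρ k) f) ≡ true → ρ k (suc f) ∧ (count (ρ k) (suc f) ≡ᵇ suc (count (ρ (suc k)) f)) ≡ true
      to h with ∧-true {ρ k (suc f)} h
      ... | r , e = cong₂ _∧_ r (≡ᵇ-true (trans (count-hit (ρ k) r) (cong suc (trans (sym (≡ᵇ-sound {suc δ} e)) eq))))
      from : ρ k (suc f) ∧ (count (ρ k) (suc f) ≡ᵇ suc (count (ρ (suc k)) f)) ≡ true → ρ k (suc f) ∧ (suc δ ≡ᵇ count (ρ k) f) ≡ true
      from h with ∧-true {ρ k (suc f)} h
      ... | r , e = cong₂ _∧_ r (≡ᵇ-true (trans eq (suc-injective (trans (sym (≡ᵇ-sound {count (ρ k) (suc f)} e)) (count-hit (ρ k) r)))))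

    module _ {f : ℕ} (f<m : f < m) {G : Filling} (G-stage : Shape (stage f) G) where

      v : ℕ
      v = m ∸ f

      isNum-above : ∀ k δ c → k + δ + c ≡ n → suc δ ≡ count (ρ k) f → isNum v (G k c) ≡ blocked k f
      isNum-above zero    δ c sum eq = cong (isNum v) (top G-stage c)
      isNum-above (suc k) δ c sum eq = trans
        (cong (isNum v) (box G-stage k (suc δ) c (trans (cong (_+ c) (+-suc k δ)) sum)))
        (trans (isNum-stage k (suc δ) f<m) (blocked-above k f eq))

      isNum-left : ∀ k δ c → k + δ + c ≡ n → suc δ ≡ count (ρ k) f → isNum v (left G (suc k) c) ≡ ρ k (suc f)
      -- A dot in column 0 would need more entries than the row has boxes.
      isNum-left k δ zero    sum eq = contradiction (≤-trans (≤-reflexive eq) (≤-trans (bounded k f)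
        (≤-reflexive (trans (cong (_∸ k) (trans (sym sum) (+-identityʳ _))) (m+n∸m≡n k δ))))) 1+n≰n
      isNum-left k δ (suc c) sum eq = trans
        (cong (isNum v) (box G-stage k (suc δ) c (trans (trans (cong (_+ c) (+-suc k δ)) (sym (+-suc (k + δ) c))) sum)))
        (trans (isNum-stage k (suc δ) f<m) (trans (cong (ρ k (suc f) ∧_) (≡ᵇ-true eq)) (∧-identityʳ _)))

      isDot-right : ∀ k δ c → k + δ + c ≡ n → δ ≡ count (ρ k) f → isDot (G (suc k) (suc c)) ≡ dot k f
      isDot-right k zero c sum eq = trans
        (cong isDot (outside G-stage k (suc c) (≤-reflexive (trans (cong suc (sym (trans (cong (_+ c) (sym (+-identityʳ k))) sum))) (sym (+-suc k c))))))
        (true-⇔ (λ ()) λ d → case trans eq (count-dotted C⊆ inter k f d) of λ ())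
      isDot-right k (suc δ) c sum eq = trans
        (cong isDot (box G-stage k δ (suc c) (trans (+-suc (k + δ) c) (trans (cong (_+ c) (sym (+-suc k δ))) sum))))
        (trans (isDot-stage f k δ) (true-⇔ (λ h → proj₁ (∧-true h))
          λ d → cong₂ _∧_ d (≡ᵇ-true (suc-injective (trans eq (count-dotted C⊆ inter k f d))))))

      isDot-below : ∀ k δ c → k + δ + c ≡ n → δ ≡ count (ρ k) f → ρ k (suc f) ≡ true →
        isDot (G (suc (suc k)) c) ≡ dot (suc k) f ∧ push k f
      isDot-below k zero c sum eq r = trans
        (cong isDot (outside G-stage (suc k) c (≤-reflexive (cong suc (sym (trans (cong (_+ c) (sym (+-identityʳ k))) sum))))))
        (true-⇔ (λ ()) λ h → let d , p = ∧-true {dot (suc k) f} h in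
          case trans (trans eq (suc-injective (trans (sym (count-hit (ρ k) r)) (push-count k f p)))) (count-dotted C⊆ inter (suc k) f d) of λ ())
      isDot-below k (suc δ) c sum eq r = trans
        (cong isDot (box G-stage (suc k) δ c (trans (cong (_+ c) (sym (+-suc k δ))) sum)))
        (trans (isDot-stage f (suc k) δ) (true-⇔ to from))
        where
        to : dot (suc k) f ∧ (δ ≡ᵇ count (ρ′ (suc k)) f) ≡ true → dot (suc k) f ∧ push k f ≡ true
        to h with ∧-true {dot (suc k) f} h
        ... | d , e = cong₂ _∧_ d (trans (push-def k f) (cong₂ _∧_ r (≡ᵇ-true
          (trans (count-hit (ρ k) r) (cong suc (trans (sym eq) (trans (cong suc (≡ᵇ-sound {δ} e)) (sym (count-dotted C⊆ inter (suc k) f d)))))))))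
        from : dot (suc k) f ∧ push k f ≡ true → dot (suc k) f ∧ (δ ≡ᵇ count (ρ′ (suc k)) f) ≡ true
        from h with ∧-true {dot (suc k) f} h
        ... | d , p = cong₂ _∧_ d (≡ᵇ-true (suc-injective (trans eq (trans
          (suc-injective (trans (sym (count-hit (ρ k) r)) (push-count k f p))) (count-dotted C⊆ inter (suc k) f d)))))

      -- Entries already treated differ from `v` and stay. A dot is filled from above or from the
      -- left, or remains. Among the other entries only `v` can move, and it leaves a dot exactly
      -- when `dot k (suc f)` holds.
      step-box : ∀ k δ c → k + δ + c ≡ n →
        stepCell v (stage f k δ) (G k c) (left G (suc k) c) (G (suc (suc k)) c) (G (suc k) (suc c)) ≡ stage (suc f) k δ
      step-box k δ c sum with view f k δ
      ... | new lt rewrite stage-new {f} {k} lt = trans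
        (keep v (look (ρ′ k) f δ) miss (look-not-• (ρ′ k) f))
        (sym (trans (stage-new {suc f} {k} (<-≤-trans lt (count-mono (ρ′ k) (n≤1+n f)))) (look-stable (ρ′ k) (n≤1+n f) lt)))
        where
        miss : isNum v (look (ρ′ k) f δ) ≡ false
        miss = trans (cong (isNum v) (sym (stage-new {f} {k} lt))) (trans (isNum-stage k δ f<m)
          (trans (cong (ρ k (suc f) ∧_) (≡ᵇ-false (<⇒≢ (<-≤-trans lt (count′≤count k f))))) (∧-zeroʳ _)))
      ... | dotted d eq rewrite stage-dot {f} {k} d eq
        | isNum-above k δ c sum (trans (cong suc eq) (sym (count-dotted C⊆ inter k f d)))
        | isNum-left k δ c sum (trans (cong suc eq) (sym (count-dotted C⊆ inter k f d))) = filled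
        where
        fill : ρ′ k (suc f) ≡ true → stage (suc f) k δ ≡ num v
        fill r′ = trans (stage-new {suc f} {k} (≤-reflexive (trans (cong suc eq) (sym (count-hit (ρ′ k) r′)))))
          (look-hit (ρ′ k) ≤-refl r′ eq)
        filled : (if blocked k f ∨ ρ k (suc f) then num v else •) ≡ stage (suc f) k δ
        filled with true-or-false (blocked k f) | true-or-false (ρ k (suc f))
        ... | inj₁ b | inj₁ r = trans (cong (λ x → if x ∨ ρ k (suc f) then num v else •) b) (sym (fill (remove-hit k f r (inj₁ d))))
        ... | inj₁ b | inj₂ r = trans (cong (λ x → if x ∨ ρ k (suc f) then num v else •) b) (sym (fill (remove-blocked k f r d b)))
        ... | inj₂ b | inj₁ r = trans (cong₂ (λ x y → if x ∨ y then num v else •) b r) (sym (fill (remove-hit k f r (inj₁ d))))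
        ... | inj₂ b | inj₂ r = trans (cong₂ (λ x y → if x ∨ y then num v else •) b r)
          (sym (stage-dot {suc f} {k} d′ (suc-injective (begin
            suc δ                       ≡⟨ cong suc eq ⟩
            suc (count (ρ′ k) f)        ≡⟨ count-dotted C⊆ inter k f d ⟨
            count (ρ k) f               ≡⟨ count-miss (ρ k) r ⟨
            count (ρ k) (suc f)         ≡⟨ count-dotted C⊆ inter k (suc f) d′ ⟩
            suc (count (ρ′ k) (suc f))  ∎))))
          where
          open ≡-Reasoning
          d′ : dot k (suc f) ≡ true
          d′ = dot-kept k f r d b
      ... | old le rewrite stage-old {f} {k} le with true-or-false (ρ k (suc f) ∧ (δ ≡ᵇ count (ρ k) f))
      ...   | inj₂ miss = trans (keep v (look (ρ k) m δ) (trans (isNum-look (ρ k) f<m) miss) (look-not-• (ρ k) m)) (sym (stage-old {suc f} {k} le′))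
        where
        le′ : count (ρ k) (suc f) ≤ δ
        le′ with true-or-false (ρ k (suc f))
        ... | inj₂ r = ≤-trans (≤-reflexive (count-miss (ρ k) r)) le
        ... | inj₁ r = ≤-trans (≤-reflexive (count-hit (ρ k) r)) (≤∧≢⇒< le λ e →
          case trans (sym (cong₂ _∧_ r (≡ᵇ-true (sym e)))) miss of λ ())
      ...   | inj₁ hit = trans (cong (λ x → stepCell v x (G k c) (left G (suc k) c) (G (suc (suc k)) c) (G (suc k) (suc c))) (look-hit (ρ k) f<m r eq))
          (trans (cong₂ (λ x y → if x ∧ y then • else num v) (≡ᵇ-true {v} refl) moves) moved)
        where
        r : ρ k (suc f) ≡ true
        r = proj₁ (∧-true hit)
        eq : δ ≡ count (ρ k) f
        eq = ≡ᵇ-sound (proj₂ (∧-true {ρ k (suc f)} hit))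
        moves : isDot (G (suc (suc k)) c) ∨ isDot (G (suc k) (suc c)) ≡ dot k (suc f)
        moves = trans (cong₂ _∨_ (isDot-below k δ c sum eq r) (isDot-right k δ c sum eq))
          (trans (∨-comm _ (dot k f)) (sym (dot-hit k f r)))
        moved : (if dot k (suc f) then • else num v) ≡ stage (suc f) k δ
        moved with true-or-false (dot k (suc f))
        ... | inj₁ d = trans (cong (if_then • else num v) d) (sym (stage-dot {suc f} {k} d
          (trans eq (suc-injective (trans (sym (count-hit (ρ k) r)) (count-dotted C⊆ inter k (suc f) d))))))
        ... | inj₂ d = trans (cong (if_then • else num v) d) (sym (trans
          (stage-new {suc f} {k} (≤-reflexive (trans (cong suc eq) (trans (sym (count-hit (ρ k) r)) (count-undotted C⊆ inter k (suc f) d)))))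
          (look-hit (ρ′ k) ≤-refl (remove-hit k f r (inj₂ d)) (trans eq (count-undotted C⊆ inter k f undotted)))))
          where
          undotted : dot k f ≡ false
          undotted with true-or-false (dot k f)
          ... | inj₂ u = u
          ... | inj₁ u = case trans (sym (Removable.persist (dot-removable C⊆ k) f r u)) d of λ ()

      step-shape : Shape (stage (suc f)) (rjdtStep v G)
      step-shape = record
        { top     = λ c → at 0 c (top G-stage c)
        ; outside = λ k c h → at (suc k) c (outside G-stage k c h)
        ; box     = λ k δ c sum → trans (at (suc k) c (box G-stage k δ c sum)) (step-box k δ c sum)
        }
        where
        at : ∀ r c {x} → G r c ≡ x → rjdtStep v G r c ≡ stepCell v x (above G r c) (left G r c) (below G r c) (right G r c)
        at r c refl = rjdtStep-local v G r c

    steps-shape : ∀ d f {G} → f + d ≡ m → Shape (stage f) G → Shape (stage m) (rjdtSteps d G)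
    steps-shape zero    f refl s rewrite +-identityʳ f = s
    -- After `f` of `m` steps the next value `suc d` is `m ∸ f`.
    steps-shape (suc d) f {G} sum s = steps-shape d (suc f) (trans (sym (+-suc f d)) sum)
      (subst (λ i → Shape (stage (suc f)) (rjdtStep i G)) (trans (cong (_∸ f) (sym sum)) (m+n∸m≡n f (suc d)))
        (step-shape (≤-trans (m<m+n f (s≤s z≤n)) (≤-reflexive sum)) s))

    overlay-stage : ∀ {B F} → Marks C B → Represents ρ F → Shape (stage 0) (overlay B F)
    overlay-stage {B} {F} marks s = record
      { top     = λ c → trans (cong (if_then • else F 0 c) (top-mark marks c)) (top s c)
      ; outside = λ k c h → trans (cong (if_then • else F (suc k) c) (outside-mark marks k c h)) (outside s k c h)
      ; box     = λ k δ c sum → trans (cong₂ (if_then • else_) (box-mark marks k δ c sum) (box s k δ c sum)) (initial k δ)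
      }
      where
      initial : ∀ k δ → (if C k ∧ (δ ≡ᵇ 0) then • else look (ρ k) m δ) ≡ stage 0 k δ
      initial k δ with view 0 k δ
      initial k δ | dotted d eq = trans
        (cong₂ (λ x y → if x ∧ y then • else look (ρ k) m δ) d (≡ᵇ-true {δ} (trans eq
          (suc-injective (trans (sym (count-dotted C⊆ inter k 0 d)) (cong bit (C⊆ k d)))))))
        (sym (stage-dot {0} {k} d eq))
      initial k δ | old le with true-or-false (C k)
      ... | inj₂ c = trans (cong (λ x → if x ∧ (δ ≡ᵇ 0) then • else look (ρ k) m δ) c) (sym (stage-old {0} {k} le))
      ... | inj₁ c = trans (cong₂ (λ x y → if x ∧ y then • else look (ρ k) m δ) c
        (≡ᵇ-false {δ} (>⇒≢ (≤-trans (≤-reflexive (cong bit (sym (C⊆ k c)))) le)))) (sym (stage-old {0} {k} le))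
      initial k δ | new lt with true-or-false (C k)
      ... | inj₁ c = contradiction (≤-trans (s≤s (≤-trans (s≤s z≤n) lt)) (≤-trans (≤-reflexive (sym (count-dotted C⊆ inter k 0 c))) (bit≤1 (ρ k 0)))) 1+n≰n
      ... | inj₂ c = trans (cong (λ x → if x ∧ (δ ≡ᵇ 0) then • else look (ρ k) m δ) c) (trans
        (look-stable (ρ k) {g = m} z≤n (<-≤-trans lt (count′≤count k 0))) (sym (stage-new {0} {k} lt)))

    -- Once all `m` values have been treated, a remaining dot lies to the left of all entries of its
    -- row, where `look` is empty anyway.
    final-clean : ∀ k δ → clean (stage m k δ) ≡ look (ρ′ k) m δ
    final-clean k δ with view m k δ
    ... | new lt rewrite stage-new {m} {k} lt = clean-look (look (ρ′ k) m δ) (look-not-• (ρ′ k) m)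
      where
      clean-look : ∀ x → x ≢ • → clean x ≡ x
      clean-look ∅       _  = refl
      clean-look •       x≢ = contradiction refl x≢
      clean-look (num x) _  = refl
    ... | dotted d eq rewrite stage-dot {m} {k} d eq = sym (look-empty (ρ′ k) {m} (≤-reflexive (sym eq)))
    ... | old le rewrite stage-old {m} {k} le | look-empty (ρ k) {m} le = sym (look-empty (ρ′ k) {m} (≤-trans (count′≤count k m) le))

    Represents⇒Below : ∀ {F} → Represents ρ F → Below m F
    Represents⇒Below s r c x eq with Shape-cell s r c
    ... | inj₁ e = case trans (sym e) eq of λ ()
    ... | inj₂ (k , δ , refl , sum , e) with look-num (ρ k) m (trans (sym e) eq)
    ...   | h , _ , _ , _ , refl = m∸n≤m m h

    rjdt-represents : ∀ {a B F} → Marks C B → Below a F → Represents ρ F →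
      Represents ρ′ (deleteDots (rjdtSteps a (overlay B F)))
    rjdt-represents {a} {B} {F} marks below s = record
      { top     = λ c → trans (deleteDots-local R 0 c) (cong clean (top shape c))
      ; outside = λ k c h → trans (deleteDots-local R (suc k) c) (cong clean (outside shape k c h))
      ; box     = λ k δ c sum → trans (deleteDots-local R (suc k) c) (trans (cong clean (box shape k δ c sum)) (final-clean k δ))
      }
      where
      R : Filling
      R = rjdtSteps a (overlay B F)
      shape : Shape (stage m) R
      shape = Shape-cong (rjdtSteps-bound (overlay-Below {B = B} (Represents⇒Below s)) (overlay-Below {B = B} below))
        (steps-shape m 0 refl (overlay-stage marks s))

-- Reading the statistics off the recording tableau.

count-cong : ∀ {τ τ′} f → (∀ g → g ≤ f → τ g ≡ τ′ g) → count τ f ≡ count τ′ f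
count-cong zero    e = cong bit (e 0 z≤n)
count-cong (suc f) e = cong₂ (λ b c → bit b + c) (e (suc f) ≤-refl) (count-cong f λ g g≤f → e g (m≤n⇒m≤1+n g≤f))

walk-cong : ∀ {τ τ′ t t′} f → (∀ g → g ≤ f → τ g ≡ τ′ g) → (∀ g → g ≤ f → t g ≡ t′ g) → walk τ t f ≡ walk τ′ t′ f
walk-cong zero    e e′ = refl
walk-cong (suc f) e e′ = cong₂ _⊓_
  (cong₂ (λ b c → bit b + c) (e (suc f) ≤-refl) (walk-cong f (λ g g≤f → e g (m≤n⇒m≤1+n g≤f)) (λ g g≤f → e′ g (m≤n⇒m≤1+n g≤f))))
  (e′ f (n≤1+n f))

cost-cong : ∀ {ρ ρ′} s k f → (∀ j g → j ≤ s + k → g ≤ f → ρ j g ≡ ρ′ j g) → cost ρ s k f ≡ cost ρ′ s k f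
cost-cong zero    k f e = count-cong f λ g → e k g ≤-refl
cost-cong (suc s) k f e = walk-cong f (λ g → e k g (m≤n+m k (suc s)))
  λ g g≤f → cost-cong s (suc k) g λ j h j≤ h≤g → e j h (≤-trans j≤ (≤-reflexive (+-suc s k))) (≤-trans h≤g g≤f)

maxEntry-bound : ∀ b F {r c} → r < b → c < b → cellVal (F (suc r) (suc c)) ≤ maxEntry b F
maxEntry-bound b F {r} {c} r<b c<b = foldr-preservesᵒ
  (λ x y → Sum.[ (λ le → ≤-trans le (m≤m⊔n x y)) , (λ le → ≤-trans le (m≤n⊔m x y)) ]) 0 _
  (inj₂ (lose (∈-concat⁺′ (∈-map⁺ (λ c → cellVal (F (suc r) (suc c))) (∈-upTo⁺ c<b)) (∈-map⁺ _ (∈-upTo⁺ r<b))) ≤-refl))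

slice-∷ʳ : ∀ ℓ lo d → slice ℓ lo (suc d) ≡ slice ℓ lo d ++ [ ℓ (lo + d) ]
slice-∷ʳ ℓ lo zero    = cong (λ z → ℓ z ∷ []) (sym (+-identityʳ lo))
slice-∷ʳ ℓ lo (suc d) = cong (ℓ lo ∷_) (trans (slice-∷ʳ ℓ (suc lo) d)
  (cong (λ z → slice ℓ (suc lo) d ++ [ ℓ z ]) (sym (+-suc lo d))))

reverse-slice : ∀ m ℓ a d b → a + d + b ≡ suc m → reverse (slice ℓ a d) ≡ slice (λ k → ℓ (m ∸ k)) b d
reverse-slice m ℓ a zero    b sum = refl
reverse-slice m ℓ a (suc d) b sum = begin
  reverse (ℓ a ∷ slice ℓ (suc a) d)                              ≡⟨ unfold-reverse (ℓ a) (slice ℓ (suc a) d) ⟩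
  reverse (slice ℓ (suc a) d) ++ [ ℓ a ]                         ≡⟨ cong₂ _++_ (reverse-slice m ℓ (suc a) d b (trans (cong (_+ b) (sym (+-suc a d))) sum)) (cong (λ z → [ ℓ z ]) (sym last)) ⟩
  slice (λ k → ℓ (m ∸ k)) b d ++ [ ℓ (m ∸ (b + d)) ]             ≡⟨ slice-∷ʳ _ b d ⟨
  slice (λ k → ℓ (m ∸ k)) b (suc d) ∎
  where
  open ≡-Reasoning
  last : m ∸ (b + d) ≡ a
  last = trans (cong (_∸ (b + d)) (suc-injective (trans (sym sum)
    (trans (cong (_+ b) (+-suc a d)) (cong suc (trans (+-assoc a d b) (cong (a +_) (+-comm d b))))))))
    (m+n∸n≡m a (b + d))

slice-shift : ∀ ℓ lo d → slice (λ k → ℓ (suc k)) lo d ≡ slice ℓ (suc lo) d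
slice-shift ℓ lo zero    = refl
slice-shift ℓ lo (suc d) = cong (ℓ (suc lo) ∷_) (slice-shift ℓ (suc lo) d)

take-drop-slice : ∀ xs lo d → lo + d ≤ length xs → take d (drop lo xs) ≡ slice (nth xs) lo d
take-drop-slice xs       lo       zero    le = refl
take-drop-slice []       zero     (suc d) ()
take-drop-slice []       (suc lo) (suc d) ()
take-drop-slice (x ∷ xs) zero     (suc d) (s≤s le) = cong (x ∷_)
  (trans (take-drop-slice xs 0 d le) (slice-shift (nth (x ∷ xs)) 0 d))
take-drop-slice (x ∷ xs) (suc lo) (suc d) (s≤s le) =
  trans (take-drop-slice xs lo (suc d) le) (slice-shift (nth (x ∷ xs)) lo (suc d))

module Recording (m : ℕ) where
  open Staircase m

  module _ (ℓ : ℕ → ℕ) where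
    open Evolution n ℓ

    bounded-initial : Bounded (state 0)
    bounded-initial k f with true-or-false (k + f <ᵇ n)
    ... | inj₁ lt = ≤-trans (≤-reflexive (count-initial k f (<ᵇ-true⁻ lt)))
      (≤-trans (≤-reflexive (sym (m+n∸m≡n k (suc f)))) (∸-monoˡ-≤ k (≤-trans (≤-reflexive (+-suc k f)) (<ᵇ-true⁻ lt))))
    bounded-initial k zero    | inj₂ ge = ≤-trans (≤-reflexive (cong bit ge)) z≤n
    bounded-initial k (suc f) | inj₂ ge = ≤-trans (≤-reflexive (count-miss (state 0 k) ge)) (bounded-initial k f)

  Mstair-represents : ∀ ℓ → Represents (Evolution.state n ℓ 0) (Mstair m)
  Mstair-represents ℓ = record { top = λ c → refl ; box = boxes ; outside = outer }
    where
    open Evolution n ℓ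
    outer : ∀ k c → n < k + c → Mstair m (suc k) c ≡ ∅
    outer k c gt = if-false (trans (cong ((0 <ᵇ c) ∧_) (<ᵇ-false (<⇒≤ gt))) (∧-zeroʳ (0 <ᵇ c)))
    boxes : ∀ k δ c → k + δ + c ≡ n → Mstair m (suc k) c ≡ look (state 0 k) m δ
    boxes k δ c sum with look (state 0 k) m δ in eq
    ... | • = contradiction eq (look-not-• (state 0 k) m)
    ... | num x with look-num (state 0 k) m eq
    ...   | h , h<m , t , refl , refl rewrite count-initial k h (<-trans (+-monoʳ-< k (n<1+n h)) (<ᵇ-true⁻ t)) =
      trans (if-true (cong₂ _∧_ (<ᵇ-true⁺ c>0) (<ᵇ-true⁺ (s≤s kc≤m)))) (cong num value)
      where
      split : k + c + h ≡ m
      split = suc-injective (trans (trans (cong suc (+-assoc k c h)) (trans (cong (λ z → suc (k + z)) (+-comm c h)) (trans (cong suc (sym (+-assoc k h c))) (cong (_+ c) (sym (+-suc k h)))))) sum)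
      kc≤m : k + c ≤ m
      kc≤m = ≤-trans (m≤m+n (k + c) h) (≤-reflexive split)
      c>0 : 0 < c
      c>0 = n≢0⇒n>0 λ { refl → <⇒≢ (<ᵇ-true⁻ t) (trans (sym (+-identityʳ _)) sum) }
      value : k + c ≡ m ∸ h
      value = trans (sym (m+n∸n≡m (k + c) h)) (cong (_∸ h) split)
    boxes k zero c sum | ∅ = if-false (trans (cong ((0 <ᵇ c) ∧_) (<ᵇ-false (≤-reflexive (trans (sym sum) (cong (_+ c) (+-identityʳ k)))))) (∧-zeroʳ (0 <ᵇ c)))
    boxes k (suc h) zero sum | ∅ = refl
    boxes k (suc h) (suc c) sum | ∅ = case trans (sym eq) (look-hit (state 0 k) h<m (<ᵇ-true⁺ kh<n) (sym (count-initial k h (<-trans (+-monoʳ-< k (n<1+n h)) kh<n)))) of λ ()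
      where
      kh<n : k + suc h < n
      kh<n = ≤-trans (m<m+n (k + suc h) (s≤s z≤n)) (≤-reflexive sum)
      h<m : h < m
      h<m = ≤-trans (m≤n+m (suc h) k) (≤-pred kh<n)

  Mstair-sym : ∀ r c → Mstair m r c ≡ Mstair m c r
  Mstair-sym zero    zero    = refl
  Mstair-sym zero    (suc c) = refl
  Mstair-sym (suc r) zero    = refl
  Mstair-sym (suc r) (suc c) rewrite +-suc r c | +-suc c r | +-comm r c = refl

  Represents⇒Below-max : ∀ {ρ F} → Bounded ρ → Represents ρ F → Below (maxEntry n F) F
  Represents⇒Below-max {ρ} {F} bd s r c x eq with Shape-cell s r c
  ... | inj₁ e = case trans (sym e) eq of λ ()
  ... | inj₂ (k , δ , refl , sum , e) with look-num (ρ k) m (trans (sym e) eq)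
  Represents⇒Below-max {ρ} {F} bd s r zero x eq | inj₂ (k , δ , refl , sum , e) | h , h<m , t , refl , _ =
    contradiction (≤-trans (≤-reflexive (sym (count-hit (ρ k) t))) (≤-trans (bd k (suc h))
      (≤-reflexive (trans (cong (_∸ k) (trans (sym sum) (+-identityʳ _))) (m+n∸m≡n k _))))) 1+n≰n
  Represents⇒Below-max {ρ} {F} bd s r (suc c) x eq | inj₂ (k , δ , refl , sum , e) | _ =
    ≤-trans (≤-reflexive (cong cellVal (sym eq))) (maxEntry-bound n F
      (≤-trans (s≤s (≤-trans (m≤m+n k δ) (m≤m+n (k + δ) c))) (≤-reflexive (trans (sym (+-suc (k + δ) c)) sum)))
      (≤-trans (m≤n+m (suc c) (k + δ)) (≤-reflexive sum)))

  -- The bound `b` is existential, since words with the same tableau may have different largest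
  -- letters.
  Recorded : (ℕ → ℕ) → Filling → Set
  Recorded ℓ F = ∃[ b ] (∀ k → k < n → ℓ k ≤ b) × (∀ k → k < n → 0 < ℓ k) × Bounded (Evolution.state n ℓ b) × Represents (Evolution.state n ℓ b) F

  -- The box where `ρ₁` places the entry holds the same number in `G`, and `look-num` traces that
  -- number back to a bit of `ρ₂`.
  shared-entry : ∀ {ρ₁ ρ₂ F G} → Bounded ρ₁ → Represents ρ₁ F → Represents ρ₂ G → F ≗₂ G →
    ∀ k h → k < n → h < m → ρ₁ k (suc h) ≡ true → ρ₂ k (suc h) ≡ true
  shared-entry {ρ₁} {ρ₂} bd s₁ s₂ e k h k<n h<m t
    with look-num (ρ₂ k) m (trans (sym (trans (sym (box s₁ k δ c sum)) (trans (e (suc k) c) (box s₂ k δ c sum)))) (look-hit (ρ₁ k) h<m t refl))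
    where
    δ c : ℕ
    δ = count (ρ₁ k) h
    -- The column of that box; `bd` and `k<n` make both subtractions exact.
    c = n ∸ k ∸ δ
    sum : k + δ + c ≡ n
    sum = trans (+-assoc k δ c) (trans (cong (k +_) (m+[n∸m]≡n (bd k h))) (m+[n∸m]≡n (<⇒≤ k<n)))
  ... | g , g<m , t′ , _ , eq with ∸-cancelˡ-≡ (<⇒≤ h<m) (<⇒≤ g<m) eq
  ...   | refl = t′

  -- By `lds-cost` both sides are `d` minus a cost, and a cost sees only finitely many bits, which
  -- the filling determines.
  recorded-lds : ∀ {ℓ₁ ℓ₂ F G} → Recorded ℓ₁ F → Recorded ℓ₂ G → F ≗₂ G →
    ∀ lo d f → lo + d ≡ suc f → f < n → lds (slice ℓ₁ lo d) ≡ lds (slice ℓ₂ lo d)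
  recorded-lds {ℓ₁} {ℓ₂} (b₁ , ≤b₁ , pos₁ , bd₁ , s₁) (b₂ , ≤b₂ , pos₂ , bd₂ , s₂) e lo zero f sum f<n = refl
  recorded-lds {ℓ₁} {ℓ₂} (b₁ , ≤b₁ , pos₁ , bd₁ , s₁) (b₂ , ≤b₂ , pos₂ , bd₂ , s₂) e lo d@(suc d′) f sum f<n =
    +-cancelʳ-≡ (cost ρ₂ lo 0 f) _ _ (begin
      lds (slice ℓ₁ lo d) + cost ρ₂ lo 0 f ≡⟨ cong (lds (slice ℓ₁ lo d) +_) (cost-cong lo 0 f same) ⟨
      lds (slice ℓ₁ lo d) + cost ρ₁ lo 0 f ≡⟨ Evolution.lds-cost n ℓ₁ pos₁ f f<n b₁ lo d sum (all ≤b₁ lo d lo+d≤n) ⟩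
      d                                    ≡⟨ Evolution.lds-cost n ℓ₂ pos₂ f f<n b₂ lo d sum (all ≤b₂ lo d lo+d≤n) ⟨
      lds (slice ℓ₂ lo d) + cost ρ₂ lo 0 f ∎)
    where
    open ≡-Reasoning
    ρ₁ = Evolution.state n ℓ₁ b₁
    ρ₂ = Evolution.state n ℓ₂ b₂
    lo+d≤n : lo + d ≤ n
    lo+d≤n = ≤-trans (≤-reflexive sum) f<n
    all : ∀ {ℓ b} → (∀ k → k < n → ℓ k ≤ b) → ∀ lo d → lo + d ≤ n → All (_≤ b) (slice ℓ lo d)
    all ≤b lo zero    le = []
    all ≤b lo (suc d) le = ≤b lo (≤-trans (m<m+n lo (s≤s z≤n)) le) ∷ all ≤b (suc lo) d (≤-trans (≤-reflexive (sym (+-suc lo d))) le)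
    unfilled : ∀ {ℓ b} → (∀ k → k < n → 0 < ℓ k) → (∀ k → k < n → ℓ k ≤ b) → ∀ j → j < n → Evolution.state n ℓ b j 0 ≡ false
    unfilled {ℓ} {b} pos ≤b j j<n = trans (Evolution.state-unfilled n ℓ pos b j) (trans (cong ((j <ᵇ n) ∧_) (<ᵇ-false (≤b j j<n))) (∧-zeroʳ (j <ᵇ n)))
    same : ∀ j g → j ≤ lo + 0 → g ≤ f → ρ₁ j g ≡ ρ₂ j g
    same j g j≤ g≤f = go g (≤-<-trans g≤f f<n)
      where
      j<n : j < n
      j<n = ≤-<-trans (≤-trans j≤ (≤-reflexive (+-identityʳ lo))) (≤-trans (m<m+n lo (s≤s z≤n)) lo+d≤n)
      go : ∀ g → g < n → ρ₁ j g ≡ ρ₂ j g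
      -- The mark n is invisible in a filling, but all letters have been absorbed, so the bit is
      -- `false` on both sides.
      go zero    _ = trans (unfilled pos₁ ≤b₁ j j<n) (sym (unfilled pos₂ ≤b₂ j j<n))
      go (suc h) (s≤s h<m) = true-⇔
        (shared-entry bd₁ s₁ s₂ e j h j<n h<m)
        (shared-entry bd₂ s₂ s₁ (λ r c → sym (e r c)) j h j<n h<m)

  -- The letters of a word, indexed by rows and by columns.

  module _ (w : Vec ℕ n) (positive : Word n w) where

    U : Filling
    U = wordTableau n w

    letters : List ℕ
    letters = toList w

    -- The word runs from the bottom row to the top row, hence in reverse order by rows and in its
    -- own order by columns.
    byRow byColumn : ℕ → ℕ
    byRow    k = nth letters (m ∸ k)
    byColumn k = nth letters k

    antidiagonal : ∀ k δ c → k + δ + c ≡ n → (k + c ≡ᵇ n) ≡ (δ ≡ᵇ 0)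
    antidiagonal k zero    c sum = ≡ᵇ-true (trans (cong (_+ c) (sym (+-identityʳ k))) sum)
    antidiagonal k (suc δ) c sum = ≡ᵇ-false (<⇒≢ (≤-trans (+-monoˡ-≤ c (m<m+n k (s≤s z≤n))) (≤-reflexive sum)))

    row-marks : ∀ v → Marks (Evolution.moving n byRow v) (boxesWith U (suc v))
    row-marks v = record { top-mark = λ c → refl ; box-mark = boxes ; outside-mark = outer }
      where
      outer : ∀ k c → n < k + c → isNum (suc v) (U (suc k) c) ≡ false
      outer k c gt = cong (isNum (suc v)) (if-false (trans (cong ((0 <ᵇ c) ∧_) (≡ᵇ-false (>⇒≢ gt))) (∧-zeroʳ (0 <ᵇ c))))
      boxes : ∀ k δ c → k + δ + c ≡ n → isNum (suc v) (U (suc k) c) ≡ ((k <ᵇ n) ∧ (byRow k ≡ᵇ suc v)) ∧ (δ ≡ᵇ 0)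
      boxes k (suc δ) c sum = trans (cong (isNum (suc v)) (if-false (trans (cong ((0 <ᵇ c) ∧_) (antidiagonal k (suc δ) c sum)) (∧-zeroʳ (0 <ᵇ c)))))
        (sym (∧-zeroʳ _))
      boxes k zero zero sum = sym (cong (λ b → (b ∧ (byRow k ≡ᵇ suc v)) ∧ true) (<ᵇ-false (≤-reflexive (sym (trans (sym (trans (+-identityʳ _) (+-identityʳ k))) sum)))))
      boxes k zero (suc c) sum = trans (cong (isNum (suc v)) (if-true (antidiagonal k 0 (suc c) sum)))
        (trans (cong (λ z → nth letters z ≡ᵇ suc v) position)
        (sym (trans (∧-identityʳ _) (cong (_∧ (byRow k ≡ᵇ suc v)) (<ᵇ-true⁺ (s≤s (≤-trans (m≤m+n k c) (≤-reflexive k+c))))))))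
        where
        k+c : k + c ≡ m
        k+c = suc-injective (trans (trans (sym (+-suc k c)) (cong (_+ suc c) (sym (+-identityʳ k)))) sum)
        position : c ≡ m ∸ k
        position = trans (sym (m+n∸m≡n k c)) (cong (_∸ k) k+c)

    column-marks : ∀ v → Marks (Evolution.moving n byColumn v) (λ r c → boxesWith U (suc v) c r)
    column-marks v = record { top-mark = tops ; box-mark = boxes ; outside-mark = outer }
      where
      tops : ∀ c → isNum (suc v) (U c 0) ≡ false
      tops zero    = refl
      tops (suc c) = refl
      outer : ∀ k c → n < k + c → isNum (suc v) (U c (suc k)) ≡ false
      outer k zero    gt = refl
      outer k (suc c) gt = cong (isNum (suc v)) (if-false (≡ᵇ-false (>⇒≢ (≤-trans gt (≤-reflexive (trans (+-suc k c) (trans (cong suc (+-comm k c)) (sym (+-suc c k)))))))))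
      boxes : ∀ k δ c → k + δ + c ≡ n → isNum (suc v) (U c (suc k)) ≡ ((k <ᵇ n) ∧ (byColumn k ≡ᵇ suc v)) ∧ (δ ≡ᵇ 0)
      boxes k zero zero sum = sym (cong (λ b → (b ∧ (byColumn k ≡ᵇ suc v)) ∧ true) (<ᵇ-false (≤-reflexive (sym (trans (sym (trans (+-identityʳ _) (+-identityʳ k))) sum)))))
      boxes k (suc δ) zero sum = sym (∧-zeroʳ _)
      boxes k δ (suc c) sum rewrite +-suc c k | trans (cong (_≡ᵇ n) (trans (cong suc (+-comm c k)) (sym (+-suc k c)))) (antidiagonal k δ (suc c) sum)
        | <ᵇ-true⁺ {k} {n} (≤-trans (s≤s (≤-trans (m≤m+n k δ) (m≤m+n (k + δ) c))) (≤-reflexive (trans (sym (+-suc (k + δ) c)) sum))) with δ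
      ... | zero   = sym (∧-identityʳ _)
      ... | suc δ′ = sym (∧-zeroʳ _)

    stages : ℕ → Filling
    stages v = rjdtU-go n U v (Mstair m)

    byRow-positive : ∀ k → k < n → 0 < byRow k
    byRow-positive k _ = positive (m ∸ k) (s≤s (m∸n≤m m k))

    module _ (ℓ : ℕ → ℕ) (pos : ∀ k → k < n → 0 < ℓ k) where
      open Evolution n ℓ

      bounded : ∀ v → Bounded (state v)
      bounded zero    = bounded-initial ℓ
      bounded (suc v) k f = ≤-trans (Stages.count′≤count (state v) (moving v) (moving⇒unfilled pos v) (interlaced pos v) (bounded v) k f) (bounded v k f)

      evolve : ∀ v {a B F} → Marks (moving v) B → Below a F → Represents (state v) F →
        Represents (state (suc v)) (deleteDots (rjdtSteps a (overlay B F)))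
      evolve v = Stages.rjdt-represents (state v) (moving v) (moving⇒unfilled pos v) (interlaced pos v) (bounded v)

    rows-represented : ∀ v → Represents (Evolution.state n byRow v) (stages v)
    rows-represented zero    = Mstair-represents byRow
    rows-represented (suc v) = evolve byRow byRow-positive v (row-marks v)
      (Represents⇒Below-max (bounded byRow byRow-positive v) (rows-represented v)) (rows-represented v)

    -- The initial staircase is symmetric and reverse slides commute with transposition, so the
    -- transposed fillings evolve by the same rule, driven by the letters of the columns.
    columns-represented : ∀ v → Represents (Evolution.state n byColumn v) (stages v ᵗ)
    columns-represented zero    = Shape-cong Mstair-sym (Mstair-represents byColumn)
    columns-represented (suc v) = Shape-cong
      (λ r c → trans (deleteDots-local (rjdtSteps M O) r c) (trans
        (cong clean (rjdtSteps-transpose M {overlay (boxesWith U (suc v)) (stages v)} (λ _ _ → refl) r c))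
        (sym (deleteDots-local (rjdtSteps M (overlay (boxesWith U (suc v)) (stages v))) c r))))
      (evolve byColumn positive v (column-marks v)
        -- The number of steps is the largest entry of the untransposed filling, so the bound on
        -- entries comes from the rows.
        (λ r c → Represents⇒Below-max (bounded byRow byRow-positive v) (rows-represented v) c r) (columns-represented v))
      where
      M : ℕ
      M = maxEntry n (stages v)
      O : Filling
      O = overlay (λ r c → boxesWith U (suc v) c r) (stages v ᵗ)

    letter≤max : ∀ k → k < n → nth letters k ≤ maxEntry n U
    letter≤max k k<n = ≤-trans (≤-reflexive (cong cellVal (sym cell)))
      (maxEntry-bound n U (s≤s (m∸n≤m m k)) k<n)
      where
      cell : U (suc (m ∸ k)) (suc k) ≡ num (nth letters k)
      cell = if-true (≡ᵇ-true (trans (+-suc (m ∸ k) k) (cong suc (m∸n+n≡m (≤-pred k<n)))))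

    rows-recorded : Recorded byRow (ℳ n w)
    rows-recorded = maxEntry n U , (λ k _ → letter≤max (m ∸ k) (s≤s (m∸n≤m m k))) , byRow-positive ,
      bounded byRow byRow-positive (maxEntry n U) , rows-represented (maxEntry n U)

    columns-recorded : Recorded byColumn (ℳ n w ᵗ)
    columns-recorded = maxEntry n U , letter≤max , positive ,
      bounded byColumn positive (maxEntry n U) , columns-represented (maxEntry n U)

theorem2p14 : (n : ℕ) → 1 ≤ n → (u w : Vec ℕ n) → Word n u → Word n w →
    (∀ r c → ℳ n u r c ≡ ℳ n w r c) → u ∼cid w
theorem2p14 (suc m) _ u w pu pw eq (suc i) (suc j) _ (s≤s i≤j) (s≤s j≤m) = lis-eq , lds-eq
  where
  open Recording m
  open ≡-Reasoning
  d : ℕ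
  d = suc j ∸ i
  i+d : i + d ≡ suc j
  i+d = m+[n∸m]≡n (m≤n⇒m≤1+n i≤j)
  factor-slice : (x : Vec ℕ (suc m)) → factor (toList x) (suc i) (suc j) ≡ slice (nth (toList x)) i d
  factor-slice x = take-drop-slice (toList x) i d
    (≤-trans (≤-reflexive i+d) (≤-trans (s≤s j≤m) (≤-reflexive (sym (length-toList x)))))
  rows : (x : Vec ℕ (suc m)) → reverse (factor (toList x) (suc i) (suc j)) ≡ slice (λ k → nth (toList x) (m ∸ k)) (m ∸ j) d
  rows x = trans (cong reverse (factor-slice x)) (reverse-slice m (nth (toList x)) i d (m ∸ j)
    (trans (cong (_+ (m ∸ j)) i+d) (cong suc (m+[n∸m]≡n j≤m))))
  lds-eq : lds (factor (toList u) (suc i) (suc j)) ≡ lds (factor (toList w) (suc i) (suc j))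
  lds-eq = begin
    lds (factor (toList u) (suc i) (suc j)) ≡⟨ cong lds (factor-slice u) ⟩
    -- The factor occupies columns `suc i` to `suc j`, so the equality of tableaux is used in
    -- transposed form.
    lds (slice (nth (toList u)) i d)        ≡⟨ recorded-lds (columns-recorded u pu) (columns-recorded w pw) (λ r c → eq c r) i d j i+d (s≤s j≤m) ⟩
    lds (slice (nth (toList w)) i d)        ≡⟨ cong lds (factor-slice w) ⟨
    lds (factor (toList w) (suc i) (suc j)) ∎
  lis-eq : lis (factor (toList u) (suc i) (suc j)) ≡ lis (factor (toList w) (suc i) (suc j))
  lis-eq = begin
    lis (factor (toList u) (suc i) (suc j))                       ≡⟨ lis≡lds-reverse (factor (toList u) (suc i) (suc j)) ⟩
    lds (reverse (factor (toList u) (suc i) (suc j)))             ≡⟨ cong lds (rows u) ⟩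
    -- The factor occupies rows `suc (m ∸ j)` to `suc (m ∸ i)`; with `f = m ∸ i` the path starts at
    -- the value `suc i`.
    lds (slice (λ k → nth (toList u) (m ∸ k)) (m ∸ j) d)          ≡⟨ recorded-lds (rows-recorded u pu) (rows-recorded w pw) eq (m ∸ j) d (m ∸ i) lo+d (s≤s (m∸n≤m m i)) ⟩
    lds (slice (λ k → nth (toList w) (m ∸ k)) (m ∸ j) d)          ≡⟨ cong lds (rows w) ⟨
    lds (reverse (factor (toList w) (suc i) (suc j)))             ≡⟨ lis≡lds-reverse (factor (toList w) (suc i) (suc j)) ⟨
    lis (factor (toList w) (suc i) (suc j)) ∎
    where
    lo+d : (m ∸ j) + d ≡ suc (m ∸ i)
    lo+d = begin
      (m ∸ j) + (suc j ∸ i)   ≡⟨ +-∸-assoc (m ∸ j) (m≤n⇒m≤1+n i≤j) ⟨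
      (m ∸ j) + suc j ∸ i     ≡⟨ cong (_∸ i) (trans (+-suc (m ∸ j) j) (cong suc (m∸n+n≡m j≤m))) ⟩
      suc m ∸ i               ≡⟨ +-∸-assoc 1 (≤-trans i≤j j≤m) ⟩
      suc (m ∸ i) ∎
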